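{- Let $V$ be a finite set (case $q=1$) or a finite-dimensional $\mathbb{F}_q$-vector space (case $q\ge 2$ a prime power), let $n=\operatorname{rk}V$, $k\in\{0,\ldots,n\}$, $t\in\{0,\ldots,\min(k,n-k)\}$, and put $\lambda_{\max}={n-t\brack k-t}_q$. Let $f:{V\brack k}\to\mathbb{R}$. The following are equivalent: (i) $f\in\bar V_t^{(k)}$. (ii) There is a constant $c\in\mathbb{R}$ such that $\langle f,\delta\rangle=\lambda c$ for all $\lambda\in\mathbb{R}$ and all real $t$-$(n,k,\lambda)_q$ designs $\delta:{V\brack k}\to\mathbb{R}$. (iii) $\langle f,\delta\rangle=0$ for all signed $t$-$(n,k,0)_q$ null designs $\delta:{V\brack k}\to\mathbb{Z}$. (iv) There is a constant $c\in\mathbb{R}$ such that $\langle f,\delta\rangle=\lambda c$ for all $\lambda\in\mathbb{N}$ and all possibly non-simple $t$-$(n,k,\lambda)_q$ designs $\delta:{V\brack k}\to\mathbb{N}$. Moreover, the constant $c$ in (ii) and in (iv) necessarily equals $\frac{1}{\lambda_{\max}}\cdot\#f$.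
   Context: $\mathbb{N}=\{0,1,2,\ldots\}$. For $q=1$, "subspaces" of $V$ are subsets and $\operatorname{rk}U=\#U$; for $q\ge2$ they are $\mathbb{F}_q$-linear subspaces and $\operatorname{rk}U=\dim U$. $U\le W$ means inclusion. ${V\brack k}$ is the set of all subspaces of $V$ of rank $k$; its cardinality is the Gaussian binomial coefficient ${n\brack k}_q$ (the ordinary binomial coefficient for $q=1$). For $f,g:{V\brack k}\to\mathbb{R}$: $\langle f,g\rangle=\sum_{K\in{V\brack k}}f(K)g(K)$ and $\#f=\sum_{K\in{V\brack k}}f(K)$. For a subspace $U$ of $V$, $\boldsymbol{x}_U^{(k)}:{V\brack k}\to\mathbb{R}$ is the characteristic function of $\{K\in{V\brack k}\mid U\le K\}$. $\bar V_t^{(k)}\subseteq\mathbb{R}^{{V\brack k}}$ is the real linear span of the functions $\boldsymbol{x}_T^{(k)}$, $T\in{V\brack t}$ (equivalently the row space of the $t$-versus-$k$ inclusion matrix). For $\lambda\in\mathbb{R}$, a function $\delta:{V\brack k}\to\mathbb{R}$ is a real $t$-$(n,k,\lambda)_q$ design if $\langle\boldsymbol{x}_T^{(k)},\delta\rangle=\lambda$ for every $T\in{V\brack t}$; it is a signed design if all its values are in $\mathbb{Z}$, and a (possibly non-simple) design if all its values are in $\mathbb{N}$. A null design is a design with $\lambda=0$. -}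

module Defs where

open import Level using (0ℓ)
open import Algebra.Bundles using (CommutativeRing)
open import Algebra.Module.Bundles using (LeftModule)
import Algebra.Properties.CommutativeMonoid.Sum as CommutativeMonoidSum
import Algebra.Properties.Group as GroupProperties
open import Data.Bool.Base using (if_then_else_)
open import Data.Fin.Base as Fin using (Fin; finToFun; funToFin; combine)
import Data.Fin.Properties as Fin
open import Data.Fin.Subset using (Subset; inside; outside; _∈_; _⊆_; ∣_∣)
open import Data.Fin.Subset.Properties using (_∈?_; _⊆?_)
open import Data.Integer.Base as ℤ using (ℤ; +_)
open import Data.Irrelevant using (Irrelevant; [_])
open import Data.List.Base as List using (List; mapMaybe; foldr)
open import Data.Maybe.Base using (Maybe; just; nothing)
open import Data.Nat.Base as ℕ using (ℕ; zero; suc; NonZero; z≤n; s≤s)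
import Data.Nat.Properties as ℕ
open import Data.Product.Base using (∃; _×_; _,_; proj₁; proj₂)
open import Data.Rational.Base as ℚ using (ℚ; 0ℚ; 1ℚ; ½)
import Data.Rational.Properties as ℚ
open import Data.Refinement using (Refinement-syntax; _,_; value)
open import Data.Unit.Base using (⊤; tt)
open import Data.Vec.Base using ([]; _∷_)
open import Data.Vec.Functional using (Vector)
import Data.Vec.Functional.Relation.Binary.Equality.Setoid as VectorEquality
open import Function.Base using (_∘_)
open import Function.Bundles using (Inverse)
import Function.Construct.Composition as Compose
open import Function.Properties.Inverse using (Inverse⇒Injection)
open import Relation.Binary.Bundles using (Setoid)
open import Relation.Binary.PropositionalEquality as ≡ using (_≡_)
import Relation.Binary.Reasoning.Setoid as SetoidReasoning
open import Relation.Nullary using (¬_; Dec; yes; no; does)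
open import Relation.Nullary.Decidable using (map′; _×-dec_; _→-dec_; via-injection)
open import Relation.Unary using (Pred; Decidable)

-- Real numbers, as Cauchy sequences of rationals modulo null sequences.
-- The quotient is not formed: equality of reals is the relation _≈ᴿ_.
IsCauchy : (ℕ → ℚ) → Set
IsCauchy x = ∀ ε → 0ℚ ℚ.< ε →
  ∃ λ N → ∀ m n → N ℕ.≤ m → N ℕ.≤ n → ℚ.∣ x m ℚ.- x n ∣ ℚ.< ε

record ℝ : Set where
  constructor mkℝ
  field
    seq    : ℕ → ℚ
    cauchy : IsCauchy seq
open ℝ public

infix 4 _≈ᴿ_
_≈ᴿ_ : ℝ → ℝ → Set
x ≈ᴿ y = ∀ ε → 0ℚ ℚ.< ε →
  ∃ λ N → ∀ n → N ℕ.≤ n → ℚ.∣ seq x n ℚ.- seq y n ∣ ℚ.< ε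

fromℚ : ℚ → ℝ
fromℚ p = mkℝ (λ _ → p) λ ε 0<ε →
  0 , λ _ _ _ _ → ≡.subst (λ r → ℚ.∣ r ∣ ℚ.< ε) (≡.sym (ℚ.+-inverseʳ p)) 0<ε

fromℤ : ℤ → ℝ
fromℤ z = fromℚ (z ℚ./ 1)

fromℕ : ℕ → ℝ
fromℕ m = fromℤ (+ m)

0ᴿ 1ᴿ : ℝ
0ᴿ = fromℚ 0ℚ
1ᴿ = fromℚ 1ℚ

reciprocal : (m : ℕ) .{{_ : NonZero m}} → ℝ
reciprocal m = fromℚ (+ 1 ℚ./ m)

private
  half : ∀ {ε} → 0ℚ ℚ.< ε → 0ℚ ℚ.< ½ ℚ.* ε
  half {ε} 0<ε = ≡.subst (ℚ._< ½ ℚ.* ε) (ℚ.*-zeroʳ ½) (ℚ.*-monoʳ-<-pos ½ 0<ε)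

  half+half : ∀ ε → ½ ℚ.* ε ℚ.+ ½ ℚ.* ε ≡ ε
  half+half ε = ≡.trans (≡.sym (ℚ.*-distribʳ-+ ε ½ ½)) (ℚ.*-identityˡ ε)

  open import Data.Rational.Solver using (module +-*-Solver)
  open +-*-Solver using (solve; _:=_; _:+_; _:*_; _:-_)

  sum-of-differences : ∀ a b c d →
    (a ℚ.+ b) ℚ.- (c ℚ.+ d) ≡ (a ℚ.- c) ℚ.+ (b ℚ.- d)
  sum-of-differences =
    solve 4 (λ a b c d → (a :+ b) :- (c :+ d) := (a :- c) :+ (b :- d)) ≡.refl

  difference-of-products : ∀ a b c d →
    (a ℚ.* b) ℚ.- (c ℚ.* d) ≡ a ℚ.* (b ℚ.- d) ℚ.+ d ℚ.* (a ℚ.- c)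
  difference-of-products =
    solve 4 (λ a b c d → (a :* b) :- (c :* d) := a :* (b :- d) :+ d :* (a :- c)) ≡.refl

infixl 6 _+ᴿ_
_+ᴿ_ : ℝ → ℝ → ℝ
x +ᴿ y = mkℝ (λ n → seq x n ℚ.+ seq y n) λ ε 0<ε →
  let (M , x-close) = cauchy x (½ ℚ.* ε) (half 0<ε)
      (N , y-close) = cauchy y (½ ℚ.* ε) (half 0<ε)
  in M ℕ.⊔ N , λ m n p q → begin-strict
    ℚ.∣ (seq x m ℚ.+ seq y m) ℚ.- (seq x n ℚ.+ seq y n) ∣
      ≡⟨ ≡.cong ℚ.∣_∣ (sum-of-differences (seq x m) (seq y m) (seq x n) (seq y n)) ⟩
    ℚ.∣ (seq x m ℚ.- seq x n) ℚ.+ (seq y m ℚ.- seq y n) ∣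
      ≤⟨ ℚ.∣p+q∣≤∣p∣+∣q∣ (seq x m ℚ.- seq x n) (seq y m ℚ.- seq y n) ⟩
    ℚ.∣ seq x m ℚ.- seq x n ∣ ℚ.+ ℚ.∣ seq y m ℚ.- seq y n ∣
      <⟨ ℚ.+-mono-< (x-close m n (ℕ.m⊔n≤o⇒m≤o M N p) (ℕ.m⊔n≤o⇒m≤o M N q))
                    (y-close m n (ℕ.m⊔n≤o⇒n≤o M N p) (ℕ.m⊔n≤o⇒n≤o M N q)) ⟩
    ½ ℚ.* ε ℚ.+ ½ ℚ.* ε
      ≡⟨ half+half ε ⟩
    ε ∎
  where open ℚ.≤-Reasoning

private
  eventually-bounded : ∀ x → ∃ λ B → 0ℚ ℚ.< B ×
    ∃ λ N → ∀ n → N ℕ.≤ n → ℚ.∣ seq x n ∣ ℚ.< B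
  eventually-bounded x with cauchy x 1ℚ (ℚ.positive⁻¹ 1ℚ)
  ... | N , close = 1ℚ ℚ.+ ℚ.∣ seq x N ∣
                  , ℚ.+-mono-<-≤ (ℚ.positive⁻¹ 1ℚ) (ℚ.0≤∣p∣ (seq x N))
                  , N , λ n N≤n → begin-strict
    ℚ.∣ seq x n ∣
      ≡⟨ ≡.cong ℚ.∣_∣ (solve 2 (λ a b → a := (a :- b) :+ b) ≡.refl (seq x n) (seq x N)) ⟩
    ℚ.∣ (seq x n ℚ.- seq x N) ℚ.+ seq x N ∣
      ≤⟨ ℚ.∣p+q∣≤∣p∣+∣q∣ (seq x n ℚ.- seq x N) (seq x N) ⟩
    ℚ.∣ seq x n ℚ.- seq x N ∣ ℚ.+ ℚ.∣ seq x N ∣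
      <⟨ ℚ.+-monoˡ-< ℚ.∣ seq x N ∣ (close n N N≤n ℕ.≤-refl) ⟩
    1ℚ ℚ.+ ℚ.∣ seq x N ∣ ∎
    where open ℚ.≤-Reasoning

  small-factor : ∀ B → 0ℚ ℚ.< B → ∀ ε → 0ℚ ℚ.< ε →
    ∃ λ δ → 0ℚ ℚ.< δ × (∀ b d → ℚ.∣ b ∣ ℚ.< B → ℚ.∣ d ∣ ℚ.< δ → ℚ.∣ b ℚ.* d ∣ ℚ.< ε)
  small-factor B 0<B ε 0<ε = δ , 0<δ , bound
    where
    open ℚ.≤-Reasoning
    instance
      B-positive : ℚ.Positive B
      B-positive = ℚ.positive 0<B
      B-nonZero : ℚ.NonZero B
      B-nonZero = ℚ.pos⇒nonZero B
      1/B-positive : ℚ.Positive (ℚ.1/ B)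
      1/B-positive = ℚ.1/pos⇒pos B
    δ : ℚ
    δ = ℚ.1/ B ℚ.* ε
    0<δ : 0ℚ ℚ.< δ
    0<δ = ≡.subst (ℚ._< δ) (ℚ.*-zeroʳ (ℚ.1/ B)) (ℚ.*-monoʳ-<-pos (ℚ.1/ B) 0<ε)
    bound : ∀ b d → ℚ.∣ b ∣ ℚ.< B → ℚ.∣ d ∣ ℚ.< δ → ℚ.∣ b ℚ.* d ∣ ℚ.< ε
    bound b d b<B d<δ = begin-strict
      ℚ.∣ b ℚ.* d ∣
        ≡⟨ ℚ.∣p*q∣≡∣p∣*∣q∣ b d ⟩
      ℚ.∣ b ∣ ℚ.* ℚ.∣ d ∣
        ≤⟨ ℚ.*-monoʳ-≤-nonNeg ℚ.∣ d ∣ {{ℚ.nonNegative (ℚ.0≤∣p∣ d)}} (ℚ.<⇒≤ b<B) ⟩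
      B ℚ.* ℚ.∣ d ∣
        <⟨ ℚ.*-monoʳ-<-pos B d<δ ⟩
      B ℚ.* (ℚ.1/ B ℚ.* ε)
        ≡⟨ ≡.sym (ℚ.*-assoc B (ℚ.1/ B) ε) ⟩
      B ℚ.* ℚ.1/ B ℚ.* ε
        ≡⟨ ≡.cong (ℚ._* ε) (ℚ.*-inverseʳ B) ⟩
      1ℚ ℚ.* ε
        ≡⟨ ℚ.*-identityˡ ε ⟩
      ε ∎

infixl 7 _*ᴿ_
_*ᴿ_ : ℝ → ℝ → ℝ
x *ᴿ y = mkℝ (λ n → seq x n ℚ.* seq y n) λ ε 0<ε →
  let (B , 0<B , K , x-bounded) = eventually-bounded x
      (C , 0<C , L , y-bounded) = eventually-bounded y
      (δ , 0<δ , δ-small) = small-factor B 0<B (½ ℚ.* ε) (half 0<ε)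
      (η , 0<η , η-small) = small-factor C 0<C (½ ℚ.* ε) (half 0<ε)
      (M , x-close) = cauchy x η 0<η
      (N , y-close) = cauchy y δ 0<δ
      large : ∀ {i} → (K ℕ.⊔ L) ℕ.⊔ (M ℕ.⊔ N) ℕ.≤ i →
              (K ℕ.≤ i × L ℕ.≤ i) × (M ℕ.≤ i × N ℕ.≤ i)
      large p = let r = ℕ.m⊔n≤o⇒m≤o (K ℕ.⊔ L) (M ℕ.⊔ N) p
                    s = ℕ.m⊔n≤o⇒n≤o (K ℕ.⊔ L) (M ℕ.⊔ N) p
                in (ℕ.m⊔n≤o⇒m≤o K L r , ℕ.m⊔n≤o⇒n≤o K L r)
                 , (ℕ.m⊔n≤o⇒m≤o M N s , ℕ.m⊔n≤o⇒n≤o M N s)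
  in (K ℕ.⊔ L) ℕ.⊔ (M ℕ.⊔ N) , λ m n p q →
  let ((K≤m , _) , (M≤m , N≤m)) = large p
      ((_ , L≤n) , (M≤n , N≤n)) = large q
  in begin-strict
    ℚ.∣ (seq x m ℚ.* seq y m) ℚ.- (seq x n ℚ.* seq y n) ∣
      ≡⟨ ≡.cong ℚ.∣_∣ (difference-of-products (seq x m) (seq y m) (seq x n) (seq y n)) ⟩
    ℚ.∣ seq x m ℚ.* (seq y m ℚ.- seq y n) ℚ.+ seq y n ℚ.* (seq x m ℚ.- seq x n) ∣
      ≤⟨ ℚ.∣p+q∣≤∣p∣+∣q∣ (seq x m ℚ.* (seq y m ℚ.- seq y n)) (seq y n ℚ.* (seq x m ℚ.- seq x n)) ⟩
    ℚ.∣ seq x m ℚ.* (seq y m ℚ.- seq y n) ∣ ℚ.+ ℚ.∣ seq y n ℚ.* (seq x m ℚ.- seq x n) ∣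
      <⟨ ℚ.+-mono-<
           (δ-small (seq x m) (seq y m ℚ.- seq y n) (x-bounded m K≤m) (y-close m n N≤m N≤n))
           (η-small (seq y n) (seq x m ℚ.- seq x n) (y-bounded n L≤n) (x-close m n M≤m M≤n)) ⟩
    ½ ℚ.* ε ℚ.+ ½ ℚ.* ε
      ≡⟨ half+half ε ⟩
    ε ∎
  where open ℚ.≤-Reasoning

sumᴿ : {A : Set} → List A → (A → ℝ) → ℝ
sumᴿ xs f = foldr (λ x s → f x +ᴿ s) 0ᴿ xs

Enumeration : Setoid 0ℓ 0ℓ → ℕ → Set
Enumeration S N = Inverse S (≡.setoid (Fin N))

tuples : ∀ {S N} → Enumeration S N → ∀ k →
         Enumeration (VectorEquality.≋-setoid S k) (N ℕ.^ k)
tuples {S} {N} e k = record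
  { to        = λ v → funToFin (to ∘ v)
  ; from      = λ c i → from (finToFun c i)
  ; to-cong   = λ v≋w → funToFin-cong (λ i → to-cong (v≋w i))
  ; from-cong = λ c≡d i → from-cong (≡.cong (λ c → finToFun c i) c≡d)
  ; inverse   =
      (λ {c} v≋ → ≡.trans
        (funToFin-cong (λ i → inverseˡ (v≋ i)))
        (Fin.funToFin-finToFin {k} {N} c))
    , (λ {v} c≡ i → inverseʳ
        (≡.trans (≡.cong (λ c → finToFun c i) c≡) (Fin.finToFun-funToFin (to ∘ v) i)))
  }
  where
  open Inverse e
  funToFin-cong : ∀ {m} {f g : Fin m → Fin N} → (∀ i → f i ≡ g i) → funToFin f ≡ funToFin g
  funToFin-cong {zero}  f≗g = ≡.refl
  funToFin-cong {suc m} f≗g =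
    ≡.cong₂ combine (f≗g Fin.zero) (funToFin-cong (f≗g ∘ Fin.suc))

module _ {S N} (e : Enumeration S N) where
  open Setoid S
  open Inverse e

  module _ {P : Pred Carrier 0ℓ} (resp : ∀ {x y} → x ≈ y → P x → P y) (P? : Decidable P) where

    ∀-dec : Dec (∀ x → P x)
    ∀-dec = map′ (λ h x → resp (inverseʳ ≡.refl) (h (to x))) (λ h i → h (from i))
                 (Fin.all? (P? ∘ from))

    ∃-dec : Dec (∃ P)
    ∃-dec = map′ (λ (i , p) → from i , p)
                 (λ (x , p) → to x , resp (sym (inverseʳ ≡.refl)) p)
                 (Fin.any? (P? ∘ from))

  ≈-dec : ∀ x y → Dec (x ≈ y)
  ≈-dec = via-injection (Inverse⇒Injection e) Fin._≟_

-- The order of a finite field is automatically a prime power ≥ 2.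
record FiniteField : Set₁ where
  field
    commutativeRing : CommutativeRing 0ℓ 0ℓ
  open CommutativeRing commutativeRing public
  field
    0≉1         : ¬ 0# ≈ 1#
    invertible  : ∀ x → ¬ x ≈ 0# → ∃ λ y → x * y ≈ 1#
    order       : ℕ
    enumeration : Enumeration setoid order

VectorSpaceOver : FiniteField → Set₁
VectorSpaceOver F = LeftModule (FiniteField.ring F) 0ℓ 0ℓ

module LinearAlgebra (F : FiniteField) (V : VectorSpaceOver F) where
  open FiniteField F
  open LeftModule V
  open CommutativeMonoidSum +ᴹ-commutativeMonoid using (sum; sum-cong-≋; ∑-distrib-+)

  combination : ∀ {m} → Vector Carrier m → Vector Carrierᴹ m → Carrierᴹ
  combination a b = sum (λ i → a i *ₗ b i)

  LinearlyIndependent : ∀ {m} → Vector Carrierᴹ m → Set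
  LinearlyIndependent b = ∀ a → combination a b ≈ᴹ 0ᴹ → ∀ i → a i ≈ 0#

  IsBasisOf : Pred Carrierᴹ 0ℓ → ∀ {m} → Vector Carrierᴹ m → Set
  IsBasisOf W b = (∀ i → W (b i))
                × LinearlyIndependent b
                × (∀ v → W v → ∃ λ a → combination a b ≈ᴹ v)

  IsLinearSubspace : Pred Carrierᴹ 0ℓ → Set
  IsLinearSubspace W = W 0ᴹ
                     × (∀ u v → W u → W v → W (u +ᴹ v))
                     × (∀ a v → W v → W (a *ₗ v))

  HasDimension : Pred Carrierᴹ 0ℓ → ℕ → Set
  HasDimension W k = ∃ λ (b : Vector Carrierᴹ k) → IsBasisOf W b

  combination-cong : ∀ {m} {a a′ : Vector Carrier m} {b b′ : Vector Carrierᴹ m} →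
    (∀ i → a i ≈ a′ i) → (∀ i → b i ≈ᴹ b′ i) → combination a b ≈ᴹ combination a′ b′
  combination-cong a≋ b≋ = sum-cong-≋ (λ i → *ₗ-cong (a≋ i) (b≋ i))

  combination-injective : ∀ {m} {b : Vector Carrierᴹ m} → LinearlyIndependent b →
    ∀ {a a′} → combination a b ≈ᴹ combination a′ b → ∀ i → a i ≈ a′ i
  combination-injective {b = b} independent {a} {a′} eq i =
    GroupProperties.x∙y⁻¹≈ε⇒x≈y +-group (a i) (a′ i) (independent (λ j → a j - a′ j) difference≈0 i)
    where
    open SetoidReasoning ≈ᴹ-setoid
    difference≈0 : combination (λ j → a j - a′ j) b ≈ᴹ 0ᴹ
    difference≈0 = GroupProperties.identityˡ-unique +ᴹ-group _ (combination a′ b) (begin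
      combination (λ j → a j - a′ j) b +ᴹ combination a′ b
        ≈⟨ ∑-distrib-+ (λ j → (a j - a′ j) *ₗ b j) (λ j → a′ j *ₗ b j) ⟨
      sum (λ j → (a j - a′ j) *ₗ b j +ᴹ a′ j *ₗ b j)
        ≈⟨ sum-cong-≋ (λ j → ≈ᴹ-trans (≈ᴹ-sym (*ₗ-distribʳ (b j) (a j - a′ j) (a′ j)))
             (*ₗ-congʳ (trans (+-assoc (a j) (- a′ j) (a′ j))
               (trans (+-congˡ (-‿inverseˡ (a′ j))) (+-identityʳ (a j)))))) ⟩
      combination a b
        ≈⟨ eq ⟩
      combination a′ b ∎)

  vectors : ∀ {n} {b : Vector Carrierᴹ n} → IsBasisOf (λ _ → ⊤) b →
            Enumeration ≈ᴹ-setoid (order ℕ.^ n)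
  vectors {n} {b} (_ , independent , spanning) =
    Compose.inverse coordinates (tuples enumeration n)
    where
    coordinates : Inverse ≈ᴹ-setoid (VectorEquality.≋-setoid setoid n)
    coordinates = record
      { to        = λ v → proj₁ (spanning v tt)
      ; from      = λ a → combination a b
      ; to-cong   = λ {v} {w} v≈w → combination-injective independent
          (≈ᴹ-trans (proj₂ (spanning v tt)) (≈ᴹ-trans v≈w (≈ᴹ-sym (proj₂ (spanning w tt)))))
      ; from-cong = λ a≋ → combination-cong a≋ (λ _ → ≈ᴹ-refl)
      ; inverse   =
          (λ {_} {v} v≈ → combination-injective independent
            (≈ᴹ-trans (proj₂ (spanning v tt)) v≈))
        , (λ {v} a≋ → ≈ᴹ-trans (combination-cong a≋ (λ _ → ≈ᴹ-refl)) (proj₂ (spanning v tt)))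
      }

  module _ {N} (e : Enumeration ≈ᴹ-setoid N)
           {W : Pred Carrierᴹ 0ℓ} (resp : ∀ {u v} → u ≈ᴹ v → W u → W v) (W? : Decidable W) where

    isLinearSubspace? : Dec (IsLinearSubspace W)
    isLinearSubspace? =
      W? 0ᴹ
      ×-dec ∀-dec e (λ u≈ h v Wu Wv → resp (+ᴹ-cong u≈ ≈ᴹ-refl) (h v (resp (≈ᴹ-sym u≈) Wu) Wv))
        (λ u → ∀-dec e (λ v≈ h Wu Wv → resp (+ᴹ-cong ≈ᴹ-refl v≈) (h Wu (resp (≈ᴹ-sym v≈) Wv)))
          (λ v → W? u →-dec (W? v →-dec W? (u +ᴹ v))))
      ×-dec ∀-dec enumeration (λ a≈ h v Wv → resp (*ₗ-cong a≈ ≈ᴹ-refl) (h v Wv))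
        (λ a → ∀-dec e (λ v≈ h Wv → resp (*ₗ-cong refl v≈) (h (resp (≈ᴹ-sym v≈) Wv)))
          (λ v → W? v →-dec W? (a *ₗ v)))

    hasDimension? : ∀ k → Dec (HasDimension W k)
    hasDimension? k = ∃-dec (tuples e k)
      (λ b≋ (inW , independent , spanning) →
          (λ i → resp (b≋ i) (inW i))
        , (λ a a≈0 → independent a
            (≈ᴹ-trans (combination-cong (λ _ → refl) b≋) a≈0))
        , (λ v Wv → let (a , ab≈v) = spanning v Wv in
            a , ≈ᴹ-trans (combination-cong (λ _ → refl) (λ i → ≈ᴹ-sym (b≋ i))) ab≈v))
      (λ b →
        Fin.all? (λ i → W? (b i))
        ×-dec ∀-dec scalars
          (λ a≋ h ab≈0 i → trans (sym (a≋ i))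
            (h (≈ᴹ-trans (combination-cong a≋ (λ _ → ≈ᴹ-refl)) ab≈0) i))
          (λ a → ≈-dec e (combination a b) 0ᴹ →-dec Fin.all? (λ i → ≈-dec enumeration (a i) 0#))
        ×-dec ∀-dec e
          (λ v≈ h Wv → let (a , ab≈v) = h (resp (≈ᴹ-sym v≈) Wv) in a , ≈ᴹ-trans ab≈v v≈)
          (λ v → W? v →-dec ∃-dec scalars
            (λ a≋ ab≈v → ≈ᴹ-trans (combination-cong (λ i → sym (a≋ i)) (λ _ → ≈ᴹ-refl)) ab≈v)
            (λ a → ≈-dec e (combination a b) v)))
      where
      scalars : Enumeration (VectorEquality.≋-setoid setoid k) (order ℕ.^ k)
      scalars = tuples enumeration k

-- The first constructor is the case q = 1, the second the case q ≥ 2.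
-- A finite-dimensional vector space comes with a basis; n is its length.
data Space : Set₁ where
  finiteSet   : (A : Setoid 0ℓ 0ℓ) (n : ℕ) → Enumeration A n → Space
  vectorSpace : (F : FiniteField) (V : VectorSpaceOver F) (n : ℕ)
                (b : Vector (LeftModule.Carrierᴹ V) n) →
                LinearAlgebra.IsBasisOf F V (λ _ → ⊤) b → Space

q : Space → ℕ
q (finiteSet _ _ _)       = 1
q (vectorSpace F _ _ _ _) = FiniteField.order F

rk : Space → ℕ
rk (finiteSet _ n _)       = n
rk (vectorSpace _ _ n _ _) = n

points : Space → Setoid 0ℓ 0ℓ
points (finiteSet A _ _)       = A
points (vectorSpace _ V _ _ _) = LeftModule.≈ᴹ-setoid V

size : Space → ℕ
size (finiteSet _ n _)       = n
size (vectorSpace F _ n _ _) = FiniteField.order F ℕ.^ n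

enumerate : (V : Space) → Enumeration (points V) (size V)
enumerate (finiteSet _ _ e)           = e
enumerate (vectorSpace F V _ _ basis) = LinearAlgebra.vectors F V basis

-- Sets of points are given by their characteristic vectors along the
-- enumeration of the points, so that equality of sets is _≡_.
PointSet : Space → Set
PointSet V = Subset (size V)

⟦_⟧ : ∀ {V} → PointSet V → Pred (Setoid.Carrier (points V)) 0ℓ
⟦_⟧ {V} U v = Inverse.to (enumerate V) v ∈ U

IsSubspace : (V : Space) → PointSet V → Set
IsSubspace (finiteSet _ _ _)         U = ⊤
IsSubspace V@(vectorSpace F W _ _ _) U = LinearAlgebra.IsLinearSubspace F W (⟦_⟧ {V} U)

HasRank : (V : Space) → PointSet V → ℕ → Set
HasRank (finiteSet _ _ _)         U k = ∣ U ∣ ≡ k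
HasRank V@(vectorSpace F W _ _ _) U k = LinearAlgebra.HasDimension F W (⟦_⟧ {V} U) k

Subspace : Space → ℕ → Set
Subspace V k = [ U ∈ PointSet V ∣ IsSubspace V U × HasRank V U k ]

isSubspaceOfRank? : ∀ V k → Decidable (λ U → IsSubspace V U × HasRank V U k)
isSubspaceOfRank? (finiteSet _ _ _)         k U = yes tt ×-dec ∣ U ∣ ℕ.≟ k
isSubspaceOfRank? V@(vectorSpace F W _ _ _) k U =
  isLinearSubspace? points-enumeration respects (λ v → to v ∈? U)
  ×-dec hasDimension? points-enumeration respects (λ v → to v ∈? U) k
  where
  open LinearAlgebra F W
  points-enumeration : Enumeration (points V) (size V)
  points-enumeration = enumerate V
  open Inverse points-enumeration
  respects : ∀ {u v} → LeftModule._≈ᴹ_ W u v → to u ∈ U → to v ∈ U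
  respects u≈v = ≡.subst (_∈ U) (to-cong u≈v)

subsets : ∀ N → List (Subset N)
subsets zero    = [] List.∷ List.[]
subsets (suc N) = List.map (outside ∷_) (subsets N) List.++ List.map (inside ∷_) (subsets N)

-- Every element of Subspace V k occurs exactly once in this list.
subspaces : ∀ V k → List (Subspace V k)
subspaces V k = mapMaybe select (subsets (size V))
  where
  select : PointSet V → Maybe (Subspace V k)
  select U with isSubspaceOfRank? V k U
  ... | yes p = just (U , [ p ])
  ... | no  _ = nothing

module _ {V : Space} {k : ℕ} where

  ⟨_,_⟩ : (f g : Subspace V k → ℝ) → ℝ
  ⟨ f , g ⟩ = sumᴿ (subspaces V k) (λ K → f K *ᴿ g K)

  #_ : (Subspace V k → ℝ) → ℝ
  # f = sumᴿ (subspaces V k) f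

  -- The characteristic function of the subspaces of rank k that contain U.
  χ : ∀ {j} → Subspace V j → Subspace V k → ℝ
  χ U K = if does (value U ⊆? value K) then 1ᴿ else 0ᴿ

  -- f lies in the linear span of the finite family χ T, T of rank t.
  InSpan : ℕ → (Subspace V k → ℝ) → Set
  InSpan t f = ∃ λ (a : Subspace V t → ℝ) →
    ∀ K → f K ≈ᴿ sumᴿ (subspaces V t) (λ T → a T *ᴿ χ T K)

  IsDesign : ℕ → ℝ → (Subspace V k → ℝ) → Set
  IsDesign t l δ = ∀ (T : Subspace V t) → ⟨ χ T , δ ⟩ ≈ᴿ l

  IsSignedDesign : ℕ → ℤ → (Subspace V k → ℤ) → Set
  IsSignedDesign t l δ = IsDesign t (fromℤ l) (fromℤ ∘ δ)

  IsNonNegativeDesign : ℕ → ℕ → (Subspace V k → ℕ) → Set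
  IsNonNegativeDesign t l δ = IsDesign t (fromℕ l) (fromℕ ∘ δ)

-- The q-Pascal recursion; for q = 1 it is Pascal's rule.
gaussian : ℕ → ℕ → ℕ → ℕ
gaussian q n       zero    = 1
gaussian q zero    (suc k) = 0
gaussian q (suc n) (suc k) = gaussian q n k ℕ.+ q ℕ.^ suc k ℕ.* gaussian q n (suc k)

gaussian-nonZero : ∀ q {n k} → k ℕ.≤ n → NonZero (gaussian q n k)
gaussian-nonZero q z≤n               = _
gaussian-nonZero q (s≤s {k} {n} k≤n) =
  ℕ.>-nonZero (ℕ.<-≤-trans (ℕ.>-nonZero⁻¹ (gaussian q n k) {{gaussian-nonZero q k≤n}})
                            (ℕ.m≤m+n _ _))

λmax : (V : Space) (k t : ℕ) → ℕ
λmax V k t = gaussian (q V) (rk V ℕ.∸ t) (k ℕ.∸ t)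

λmax-nonZero : ∀ V {k} t → k ℕ.≤ rk V → NonZero (λmax V k t)
λmax-nonZero V t k≤n = gaussian-nonZero (q V) (ℕ.∸-monoˡ-≤ t k≤n)

{-# OPTIONS --safe #-}

-- Everything rests on two facts. First, the number of K of rank k above a T of
-- rank t does not depend on T: it is λmax, by counting the pairs (K , v) with
-- v ∈ K ∖ T in two ways. So the constant functions are designs. Adding a large
-- constant makes an integral null design non-negative, and conversely
-- λmax δ − l is null when δ has index l, which links (iii) and (iv) and
-- determines c. Second, elimination over ℤ on the rows of the inclusion matrix
-- M yields D ≠ 0 and a splitting D I = P + Q in which the rows of P lie in the
-- row space of M and the columns of Q are null designs. If f is orthogonal to
-- these, then D f = f P lies in the row space, so (iii) implies (i).

module Submission where

open import Defs
open import Data.Nat.Base using (ℕ; _≤_; _∸_; _⊓_)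
open import Data.Integer.Base using (ℤ; 0ℤ)
open import Data.Product.Base using (∃; _×_)
open import Function.Base using (_∘_)
open import Function.Bundles using (_⇔_)

open import Algebra.Bundles using (CommutativeMonoid; CommutativeSemiring; CommutativeRing)
open import Algebra.Module.Bundles using (LeftModule)
import Algebra.Properties.CommutativeSemigroup as CommutativeSemigroupProperties
import Algebra.Properties.Group as GroupProperties
open import Algebra.Structures using (IsCommutativeRing)
open import Data.Bool.Base using (if_then_else_; true; false)
import Data.Bool.Properties as Bool
open import Data.Empty using (⊥-elim)
open import Data.Fin.Base as Fin using (Fin)
import Data.Fin.Properties as Fin
open import Data.Fin.Subset as Subset using (Subset; inside; outside; _∈_; _∉_; _⊆_; ∣_∣; _∪_; ⁅_⁆)
import Data.Fin.Subset.Properties as Subset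
import Data.Integer.Base as ℤ
import Data.Integer.Properties as ℤ
open import Data.Integer.Solver using () renaming (module +-*-Solver to ℤ-Solver)
open import Data.Irrelevant using ([_])
open import Data.List.Base as List using (List; []; _∷_; _++_; mapMaybe; foldr; allFin)
import Data.List.Properties as List
open import Data.List.Relation.Unary.All as All using (All; []; _∷_; all?)
open import Data.List.Relation.Unary.All.Properties using (¬All⇒Any¬)
open import Data.List.Relation.Unary.Any using (satisfied)
open import Data.Maybe.Base using (Maybe; just; nothing; maybe)
open import Data.Nat.Base as ℕ using (zero; suc; NonZero; s≤s; z≤n)
import Data.Nat.Properties as ℕ
open import Data.Nat.Solver using () renaming (module +-*-Solver to ℕ-Solver)
open import Data.Product.Base using (_,_; proj₁; proj₂)
open import Data.Rational.Base as ℚ using (ℚ; 0ℚ; 1ℚ; ½)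
import Data.Rational.Properties as ℚ
open import Data.Rational.Solver using () renaming (module +-*-Solver to ℚ-Solver)
open import Data.Rational.Unnormalised.Base as ℚᵘ using (mkℚᵘ; *≡*)
import Data.Rational.Unnormalised.Properties as ℚᵘ
open import Data.Refinement using (_,_; value)
open import Data.Sum.Base using (_⊎_; inj₁; inj₂; [_,_]′)
open import Data.Unit.Base using (tt)
open import Data.Vec.Base as Vec using ([]; _∷_; here; there)
import Data.Vec.Functional as Vector
import Data.Vec.Functional.Relation.Binary.Equality.Setoid as VectorEquality
import Data.Vec.Properties as Vec
open import Function.Bundles using (mk⇔; Inverse; Equivalence)
open import Level using (0ℓ)
open import Relation.Binary.Bundles using (Setoid)
open import Relation.Binary.Definitions using (DecidableEquality)
open import Relation.Binary.PropositionalEquality as ≡ using (_≡_; _≢_)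
import Relation.Binary.Reasoning.Setoid as SetoidReasoning
open import Relation.Nullary using (¬_; Dec; yes; no; does)
open import Relation.Nullary.Decidable using (does-⇔; _×-dec_; dec-true; dec-false; map′; ¬?; recompute)
open import Relation.Nullary.Negation.Core using (contradiction-irr)
open import Relation.Unary using (Pred; Decidable)

-- The ring of real numbers

-- Equality of real numbers cannot be decided, so an elimination guided by real entries has no way
-- to find a pivot. The inclusion matrix, however, has entries 0 and 1: every zero test and every
-- pivot is taken in ℤ, independently of `f`, and the reals enter only through the inverses of the
-- non-zero integers `D` and λmax. This is also why integral null designs suffice in (iii): the
-- columns of `Q` are such designs, and orthogonality to these finitely many columns already forces
-- `f` into the row space. The constant in (ii) arises twice: from a representation of `f` in the
-- row space it is the sum of the coefficients, while testing against a constant design shows that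
-- it depends on the total of `f` alone. Sets and vector spaces differ in the number of points of a
-- subspace and in the way a point is adjoined to it. Once superspaces are counted, both cases are
-- treated together.

pointwise : ∀ {x y} → (∀ n → seq x n ≡ seq y n) → x ≈ᴿ y
pointwise {x} {y} x≗y ε 0<ε = 0 , λ n _ → ≡.subst (λ r → ℚ.∣ r ∣ ℚ.< ε)
  (≡.sym (≡.trans (≡.cong (ℚ._- seq y n) (x≗y n)) (ℚ.+-inverseʳ (seq y n)))) 0<ε

≈ᴿ-sym : ∀ {x y} → x ≈ᴿ y → y ≈ᴿ x
≈ᴿ-sym {x} {y} x≈y ε 0<ε = let (N , close) = x≈y ε 0<ε in
  N , λ n N≤n → ≡.subst (ℚ._< ε)
    (≡.trans (≡.sym (ℚ.∣-p∣≡∣p∣ (seq x n ℚ.- seq y n)))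
             (≡.cong ℚ.∣_∣ (solve 2 (λ a b → :- (a :- b) := b :- a) ≡.refl (seq x n) (seq y n))))
    (close n N≤n)
  where open ℚ-Solver using (solve; _:=_; _:-_; :-_)

½*-pos : ∀ {ε} → 0ℚ ℚ.< ε → 0ℚ ℚ.< ½ ℚ.* ε
½*-pos {ε} 0<ε = ≡.subst (ℚ._< ½ ℚ.* ε) (ℚ.*-zeroʳ ½) (ℚ.*-monoʳ-<-pos ½ 0<ε)

sum-of-small : ∀ {a b ε} → ℚ.∣ a ∣ ℚ.< ½ ℚ.* ε → ℚ.∣ b ∣ ℚ.< ½ ℚ.* ε → ℚ.∣ a ℚ.+ b ∣ ℚ.< ε
sum-of-small {a} {b} {ε} a-small b-small = begin-strict
  ℚ.∣ a ℚ.+ b ∣           ≤⟨ ℚ.∣p+q∣≤∣p∣+∣q∣ a b ⟩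
  ℚ.∣ a ∣ ℚ.+ ℚ.∣ b ∣     <⟨ ℚ.+-mono-< a-small b-small ⟩
  ½ ℚ.* ε ℚ.+ ½ ℚ.* ε    ≡⟨ ℚ.*-distribʳ-+ ε ½ ½ ⟨
  1ℚ ℚ.* ε               ≡⟨ ℚ.*-identityˡ ε ⟩
  ε                      ∎
  where open ℚ.≤-Reasoning

-- The common ε/2 argument behind transitivity and compatibility with addition; only the splitting
-- of the difference changes.
null-sum : ∀ {x y x′ y′ a b} → x ≈ᴿ x′ → y ≈ᴿ y′ →
  (∀ n → seq a n ℚ.- seq b n ≡ (seq x n ℚ.- seq x′ n) ℚ.+ (seq y n ℚ.- seq y′ n)) → a ≈ᴿ b
null-sum x≈x′ y≈y′ split ε 0<ε =
  let (M , x-close) = x≈x′ (½ ℚ.* ε) (½*-pos 0<ε)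
      (N , y-close) = y≈y′ (½ ℚ.* ε) (½*-pos 0<ε)
  in M ℕ.⊔ N , λ n p → ≡.subst (λ r → ℚ.∣ r ∣ ℚ.< ε) (≡.sym (split n))
       (sum-of-small (x-close n (ℕ.m⊔n≤o⇒m≤o M N p)) (y-close n (ℕ.m⊔n≤o⇒n≤o M N p)))

≈ᴿ-trans : ∀ {x y z} → x ≈ᴿ y → y ≈ᴿ z → x ≈ᴿ z
≈ᴿ-trans {x} {y} {z} x≈y y≈z = null-sum {x} {y} {y} {z} {x} {z} x≈y y≈z λ n →
  solve 3 (λ a b c → a :- c := (a :- b) :+ (b :- c)) ≡.refl (seq x n) (seq y n) (seq z n)
  where open ℚ-Solver using (solve; _:=_; _:+_; _:-_)

+ᴿ-cong : ∀ {x x′ y y′} → x ≈ᴿ x′ → y ≈ᴿ y′ → x +ᴿ y ≈ᴿ x′ +ᴿ y′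
+ᴿ-cong {x} {x′} {y} {y′} x≈x′ y≈y′ =
  null-sum {x} {y} {x′} {y′} {x +ᴿ y} {x′ +ᴿ y′} x≈x′ y≈y′ λ n →
  solve 4 (λ a b c d → (a :+ b) :- (c :+ d) := (a :- c) :+ (b :- d)) ≡.refl
    (seq x n) (seq y n) (seq x′ n) (seq y′ n)
  where open ℚ-Solver using (solve; _:=_; _:+_; _:-_)

-- From some index `N` on, the terms of a Cauchy sequence stay within 1 of the term at `N`. Such a
-- bound makes multiplication by `x` preserve null sequences.
eventually-bounded : ∀ x → ∃ λ B → ℚ.Positive B × ∃ λ N → ∀ n → N ℕ.≤ n → ℚ.∣ seq x n ∣ ℚ.≤ B
eventually-bounded x with cauchy x 1ℚ (ℚ.positive⁻¹ 1ℚ)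
... | N , close = 1ℚ ℚ.+ ℚ.∣ seq x N ∣
                , ℚ.positive (ℚ.+-mono-<-≤ (ℚ.positive⁻¹ 1ℚ) (ℚ.0≤∣p∣ (seq x N)))
                , N , λ n N≤n → begin
  ℚ.∣ seq x n ∣
    ≡⟨ ≡.cong ℚ.∣_∣ (solve 2 (λ a b → a := (a :- b) :+ b) ≡.refl (seq x n) (seq x N)) ⟩
  ℚ.∣ (seq x n ℚ.- seq x N) ℚ.+ seq x N ∣
    ≤⟨ ℚ.∣p+q∣≤∣p∣+∣q∣ (seq x n ℚ.- seq x N) (seq x N) ⟩
  ℚ.∣ seq x n ℚ.- seq x N ∣ ℚ.+ ℚ.∣ seq x N ∣
    ≤⟨ ℚ.+-monoˡ-≤ ℚ.∣ seq x N ∣ (ℚ.<⇒≤ (close n N N≤n ℕ.≤-refl)) ⟩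
  1ℚ ℚ.+ ℚ.∣ seq x N ∣ ∎
  where
  open ℚ-Solver using (solve; _:=_; _:+_; _:-_)
  open ℚ.≤-Reasoning

scaled-small : ∀ B → ℚ.Positive B → ∀ ε → 0ℚ ℚ.< ε →
  ∃ λ η → 0ℚ ℚ.< η × (∀ b d → ℚ.∣ b ∣ ℚ.≤ B → ℚ.∣ d ∣ ℚ.< η → ℚ.∣ b ℚ.* d ∣ ℚ.< ε)
scaled-small B B-positive ε 0<ε = η , 0<η , bound
  where
  open ℚ.≤-Reasoning
  instance
    B-pos : ℚ.Positive B
    B-pos = B-positive
    B-nonZero : ℚ.NonZero B
    B-nonZero = ℚ.pos⇒nonZero B
    1/B-positive : ℚ.Positive (ℚ.1/ B)
    1/B-positive = ℚ.1/pos⇒pos B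
  η : ℚ
  η = ℚ.1/ B ℚ.* ε
  0<η : 0ℚ ℚ.< η
  0<η = ≡.subst (ℚ._< η) (ℚ.*-zeroʳ (ℚ.1/ B)) (ℚ.*-monoʳ-<-pos (ℚ.1/ B) 0<ε)
  bound : ∀ b d → ℚ.∣ b ∣ ℚ.≤ B → ℚ.∣ d ∣ ℚ.< η → ℚ.∣ b ℚ.* d ∣ ℚ.< ε
  bound b d b≤B d<η = begin-strict
    ℚ.∣ b ℚ.* d ∣         ≡⟨ ℚ.∣p*q∣≡∣p∣*∣q∣ b d ⟩
    ℚ.∣ b ∣ ℚ.* ℚ.∣ d ∣
      ≤⟨ ℚ.*-monoʳ-≤-nonNeg ℚ.∣ d ∣ {{ℚ.nonNegative (ℚ.0≤∣p∣ d)}} b≤B ⟩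
    B ℚ.* ℚ.∣ d ∣         <⟨ ℚ.*-monoʳ-<-pos B d<η ⟩
    B ℚ.* (ℚ.1/ B ℚ.* ε)  ≡⟨ ℚ.*-assoc B (ℚ.1/ B) ε ⟨
    B ℚ.* ℚ.1/ B ℚ.* ε    ≡⟨ ≡.cong (ℚ._* ε) (ℚ.*-inverseʳ B) ⟩
    1ℚ ℚ.* ε              ≡⟨ ℚ.*-identityˡ ε ⟩
    ε                     ∎

*ᴿ-congˡ : ∀ x {y y′} → y ≈ᴿ y′ → x *ᴿ y ≈ᴿ x *ᴿ y′
*ᴿ-congˡ x {y} {y′} y≈y′ ε 0<ε =
  let (B , B-positive , M , x-bounded) = eventually-bounded x
      (η , 0<η , η-small) = scaled-small B B-positive ε 0<ε
      (N , y-close) = y≈y′ η 0<η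
  in M ℕ.⊔ N , λ n p → ≡.subst (λ r → ℚ.∣ r ∣ ℚ.< ε)
       (solve 3 (λ a b c → a :* (b :- c) := a :* b :- a :* c) ≡.refl (seq x n) (seq y n) (seq y′ n))
       (η-small (seq x n) (seq y n ℚ.- seq y′ n)
         (x-bounded n (ℕ.m⊔n≤o⇒m≤o M N p)) (y-close n (ℕ.m⊔n≤o⇒n≤o M N p)))
  where open ℚ-Solver using (solve; _:=_; _:*_; _:-_)

*ᴿ-comm : ∀ x y → x *ᴿ y ≈ᴿ y *ᴿ x
*ᴿ-comm x y = pointwise {x *ᴿ y} {y *ᴿ x} λ n → ℚ.*-comm (seq x n) (seq y n)

*ᴿ-cong : ∀ {x x′ y y′} → x ≈ᴿ x′ → y ≈ᴿ y′ → x *ᴿ y ≈ᴿ x′ *ᴿ y′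
*ᴿ-cong {x} {x′} {y} {y′} x≈x′ y≈y′ =
  ≈ᴿ-trans {x *ᴿ y} {x *ᴿ y′} {x′ *ᴿ y′} (*ᴿ-congˡ x {y} {y′} y≈y′)
  (≈ᴿ-trans {x *ᴿ y′} {y′ *ᴿ x} {x′ *ᴿ y′} (*ᴿ-comm x y′)
  (≈ᴿ-trans {y′ *ᴿ x} {y′ *ᴿ x′} {x′ *ᴿ y′} (*ᴿ-congˡ y′ {x} {x′} x≈x′) (*ᴿ-comm y′ x′)))

-- Negation is multiplication by this constant, so that its Cauchy property and its congruence come
-- from those of `_*ᴿ_`.
-1ᴿ : ℝ
-1ᴿ = fromℚ (ℚ.- 1ℚ)

ℝ-isCommutativeRing : IsCommutativeRing _≈ᴿ_ _+ᴿ_ _*ᴿ_ (-1ᴿ *ᴿ_) 0ᴿ 1ᴿ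
ℝ-isCommutativeRing = record
  { isRing = record
    { +-isAbelianGroup = record
      { isGroup = record
        { isMonoid = record
          { isSemigroup = record
            { isMagma = record
              { isEquivalence = record
                { refl  = λ {x} → pointwise {x} {x} λ _ → ≡.refl
                ; sym   = λ {x} {y} → ≈ᴿ-sym {x} {y}
                ; trans = λ {x} {y} {z} → ≈ᴿ-trans {x} {y} {z}
                }
              ; ∙-cong = λ {x} {x′} {y} {y′} → +ᴿ-cong {x} {x′} {y} {y′}
              }
            ; assoc = λ x y z → pointwise {(x +ᴿ y) +ᴿ z} {x +ᴿ (y +ᴿ z)}
                λ n → ℚ.+-assoc (seq x n) (seq y n) (seq z n)
            }
          ; identity = (λ x → pointwise {0ᴿ +ᴿ x} {x} λ n → ℚ.+-identityˡ (seq x n))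
                     , (λ x → pointwise {x +ᴿ 0ᴿ} {x} λ n → ℚ.+-identityʳ (seq x n))
          }
        ; inverse = (λ x → pointwise {(-1ᴿ *ᴿ x) +ᴿ x} {0ᴿ} λ n →
                      solve 1 (λ a → con (ℚ.- 1ℚ) :* a :+ a := con 0ℚ) ≡.refl (seq x n))
                  , (λ x → pointwise {x +ᴿ (-1ᴿ *ᴿ x)} {0ᴿ} λ n →
                      solve 1 (λ a → a :+ con (ℚ.- 1ℚ) :* a := con 0ℚ) ≡.refl (seq x n))
        ; ⁻¹-cong = λ {x} {y} → *ᴿ-congˡ -1ᴿ {x} {y}
        }
      ; comm = λ x y → pointwise {x +ᴿ y} {y +ᴿ x} λ n → ℚ.+-comm (seq x n) (seq y n)
      }
    ; *-cong = λ {x} {x′} {y} {y′} → *ᴿ-cong {x} {x′} {y} {y′}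
    ; *-assoc = λ x y z → pointwise {(x *ᴿ y) *ᴿ z} {x *ᴿ (y *ᴿ z)}
        λ n → ℚ.*-assoc (seq x n) (seq y n) (seq z n)
    ; *-identity = (λ x → pointwise {1ᴿ *ᴿ x} {x} λ n → ℚ.*-identityˡ (seq x n))
                 , (λ x → pointwise {x *ᴿ 1ᴿ} {x} λ n → ℚ.*-identityʳ (seq x n))
    ; distrib = (λ x y z → pointwise {x *ᴿ (y +ᴿ z)} {x *ᴿ y +ᴿ x *ᴿ z}
                  λ n → ℚ.*-distribˡ-+ (seq x n) (seq y n) (seq z n))
              , (λ x y z → pointwise {(y +ᴿ z) *ᴿ x} {y *ᴿ x +ᴿ z *ᴿ x}
                  λ n → ℚ.*-distribʳ-+ (seq x n) (seq y n) (seq z n))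
    }
  ; *-comm = *ᴿ-comm
  }
  where open ℚ-Solver using (solve; _:=_; _:+_; _:*_; con)

-- _+ᴿ_ and _*ᴿ_ unfold to records containing proofs of convergence, which the
-- conversion checker would compare; the ring operations are opaque to avoid this.
opaque
  _⊕_ _⊗_ : ℝ → ℝ → ℝ
  x ⊕ y = x +ᴿ y
  x ⊗ y = x *ᴿ y

  ⊕≡+ᴿ : ∀ x y → x ⊕ y ≡ x +ᴿ y
  ⊕≡+ᴿ x y = ≡.refl

  ⊗≡*ᴿ : ∀ x y → x ⊗ y ≡ x *ᴿ y
  ⊗≡*ᴿ x y = ≡.refl

  ⊕-⊗-isCommutativeRing : IsCommutativeRing _≈ᴿ_ _⊕_ _⊗_ (-1ᴿ ⊗_) 0ᴿ 1ᴿ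
  ⊕-⊗-isCommutativeRing = ℝ-isCommutativeRing

ℝ-commutativeRing : CommutativeRing _ _
ℝ-commutativeRing = record { isCommutativeRing = ⊕-⊗-isCommutativeRing }

-- The integers inside the rationals

fromℤ-+ : ∀ i j → (i ℤ.+ j) ℚ./ 1 ≡ i ℚ./ 1 ℚ.+ j ℚ./ 1
-- Reduction to lowest terms does not compute on variables; on unnormalised fractions the claim
-- becomes an identity of integers.
fromℤ-+ i j = ℚ.toℚᵘ-injective (begin-equality
  ℚ.toℚᵘ ((i ℤ.+ j) ℚ./ 1)              ≃⟨ ℚ.toℚᵘ-fromℚᵘ (mkℚᵘ (i ℤ.+ j) 0) ⟩
  mkℚᵘ (i ℤ.+ j) 0
    ≃⟨ *≡* (≡.cong (ℤ._* ℤ.+ 1) (≡.sym (≡.cong₂ ℤ._+_ (ℤ.*-identityʳ i) (ℤ.*-identityʳ j)))) ⟩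
  mkℚᵘ i 0 ℚᵘ.+ mkℚᵘ j 0
    ≃⟨ ℚᵘ.+-cong (ℚ.toℚᵘ-fromℚᵘ (mkℚᵘ i 0)) (ℚ.toℚᵘ-fromℚᵘ (mkℚᵘ j 0)) ⟨
  ℚ.toℚᵘ (i ℚ./ 1) ℚᵘ.+ ℚ.toℚᵘ (j ℚ./ 1) ≃⟨ ℚ.toℚᵘ-homo-+ (i ℚ./ 1) (j ℚ./ 1) ⟨
  ℚ.toℚᵘ (i ℚ./ 1 ℚ.+ j ℚ./ 1)           ∎)
  where open ℚᵘ.≤-Reasoning

fromℤ-* : ∀ i j → (i ℤ.* j) ℚ./ 1 ≡ i ℚ./ 1 ℚ.* (j ℚ./ 1)
fromℤ-* i j = ℚ.toℚᵘ-injective (begin-equality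
  ℚ.toℚᵘ ((i ℤ.* j) ℚ./ 1)              ≃⟨ ℚ.toℚᵘ-fromℚᵘ (mkℚᵘ (i ℤ.* j) 0) ⟩
  mkℚᵘ i 0 ℚᵘ.* mkℚᵘ j 0
    ≃⟨ ℚᵘ.*-cong (ℚ.toℚᵘ-fromℚᵘ (mkℚᵘ i 0)) (ℚ.toℚᵘ-fromℚᵘ (mkℚᵘ j 0)) ⟨
  ℚ.toℚᵘ (i ℚ./ 1) ℚᵘ.* ℚ.toℚᵘ (j ℚ./ 1) ≃⟨ ℚ.toℚᵘ-homo-* (i ℚ./ 1) (j ℚ./ 1) ⟨
  ℚ.toℚᵘ (i ℚ./ 1 ℚ.* (j ℚ./ 1))         ∎)
  where open ℚᵘ.≤-Reasoning

/1-nonZero : ∀ {i} → i ≢ 0ℤ → i ℚ./ 1 ≢ 0ℚ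
/1-nonZero {i} i≢0 i/1≡0 with ℚᵘ.≃-trans (ℚᵘ.≃-sym (ℚ.toℚᵘ-fromℚᵘ (mkℚᵘ i 0))) (ℚᵘ.≃-reflexive (≡.cong ℚ.toℚᵘ i/1≡0))
... | *≡* eq = i≢0 (≡.trans (≡.sym (ℤ.*-identityʳ i)) eq)

1/m*m≡1 : ∀ m .{{_ : NonZero m}} → ℤ.+ 1 ℚ./ m ℚ.* (ℤ.+ m ℚ./ 1) ≡ 1ℚ
1/m*m≡1 m@(suc n) = ℚ.toℚᵘ-injective (begin-equality
  ℚ.toℚᵘ (ℤ.+ 1 ℚ./ m ℚ.* (ℤ.+ m ℚ./ 1))         ≃⟨ ℚ.toℚᵘ-homo-* (ℤ.+ 1 ℚ./ m) (ℤ.+ m ℚ./ 1) ⟩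
  ℚ.toℚᵘ (ℤ.+ 1 ℚ./ m) ℚᵘ.* ℚ.toℚᵘ (ℤ.+ m ℚ./ 1)
    ≃⟨ ℚᵘ.*-cong (ℚ.toℚᵘ-fromℚᵘ (mkℚᵘ (ℤ.+ 1) n)) (ℚ.toℚᵘ-fromℚᵘ (mkℚᵘ (ℤ.+ m) 0)) ⟩
  mkℚᵘ (ℤ.+ 1) n ℚᵘ.* mkℚᵘ (ℤ.+ m) 0
    ≃⟨ *≡* (≡.trans (ℤ.*-identityʳ (ℤ.+ 1 ℤ.* ℤ.+ m)) (≡.sym (≡.cong (λ d → ℤ.+ 1 ℤ.* ℤ.+ d) (ℕ.*-identityʳ m)))) ⟩
  ℚᵘ.1ℚᵘ                                      ∎)
  where open ℚᵘ.≤-Reasoning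

-- Finite sums

-- Defs.select is not exported, so it is recovered here by unification.
selection : ∀ V k → ∃ λ (select : PointSet V → Maybe (Subspace V k)) →
            subspaces V k ≡ mapMaybe select (subsets (size V))
selection V k = _ , ≡.refl

select : ∀ V k → PointSet V → Maybe (Subspace V k)
select V k = proj₁ (selection V k)

select-yes : ∀ V k (W : Subspace V k) → select V k (value W) ≡ just W
select-yes V k (U , [ p ]) with isSubspaceOfRank? V k U
... | yes _ = ≡.refl
... | no ¬p = contradiction-irr p ¬p

select-just : ∀ V k U {W : Subspace V k} → select V k U ≡ just W → value W ≡ U
select-just V k U eq with isSubspaceOfRank? V k U
select-just V k U ≡.refl | yes _ = ≡.refl

module ListSum {c ℓ} (R : CommutativeSemiring c ℓ) where
  open CommutativeSemiring R
  open SetoidReasoning setoid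

  private variable A B : Set

  ∑ : List A → (A → Carrier) → Carrier
  ∑ xs f = foldr (λ x s → f x + s) 0# xs

  𝟙 : {P : Set} → Dec P → Carrier
  𝟙 p? = if does p? then 1# else 0#

  𝟙-true : {P : Set} (p? : Dec P) → P → 𝟙 p? ≡ 1#
  𝟙-true p? p = ≡.cong (if_then 1# else 0#) (dec-true p? p)

  𝟙-false : {P : Set} (p? : Dec P) → ¬ P → 𝟙 p? ≡ 0#
  𝟙-false p? ¬p = ≡.cong (if_then 1# else 0#) (dec-false p? ¬p)

  𝟙-⇔ : {P Q : Set} → P ⇔ Q → (p? : Dec P) (q? : Dec Q) → 𝟙 p? ≡ 𝟙 q?
  𝟙-⇔ P⇔Q p? q? = ≡.cong (if_then 1# else 0#) (does-⇔ P⇔Q p? q?)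

  𝟙-× : {P Q : Set} (p? : Dec P) (q? : Dec Q) → 𝟙 (p? ×-dec q?) ≈ 𝟙 p? * 𝟙 q?
  𝟙-× p? q? with does p? | does q?
  ... | true  | true  = sym (*-identityˡ 1#)
  ... | true  | false = sym (*-identityˡ 0#)
  ... | false | b     = sym (zeroˡ (if b then 1# else 0#))

  ∑-cong : ∀ (xs : List A) {f g} → (∀ x → f x ≈ g x) → ∑ xs f ≈ ∑ xs g
  ∑-cong []       f≈g = refl
  ∑-cong (x ∷ xs) f≈g = +-cong (f≈g x) (∑-cong xs f≈g)

  ∑-zero : ∀ (xs : List A) {f} → (∀ x → f x ≈ 0#) → ∑ xs f ≈ 0#
  ∑-zero []       f≈0 = refl
  ∑-zero (x ∷ xs) f≈0 = trans (+-cong (f≈0 x) (∑-zero xs f≈0)) (+-identityˡ 0#)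

  ∑-+ : ∀ (xs : List A) f g → ∑ xs (λ x → f x + g x) ≈ ∑ xs f + ∑ xs g
  ∑-+ []       f g = sym (+-identityˡ 0#)
  ∑-+ (x ∷ xs) f g = trans (+-congˡ (∑-+ xs f g)) (interchange (f x) (g x) (∑ xs f) (∑ xs g))
    where open CommutativeSemigroupProperties +-commutativeSemigroup using (interchange)

  ∑-*ˡ : ∀ (xs : List A) a f → ∑ xs (λ x → a * f x) ≈ a * ∑ xs f
  ∑-*ˡ []       a f = sym (zeroʳ a)
  ∑-*ˡ (x ∷ xs) a f = trans (+-congˡ (∑-*ˡ xs a f)) (sym (distribˡ a (f x) (∑ xs f)))

  ∑-*ʳ : ∀ (xs : List A) a f → ∑ xs (λ x → f x * a) ≈ ∑ xs f * a
  ∑-*ʳ xs a f = trans (∑-cong xs (λ x → *-comm (f x) a)) (trans (∑-*ˡ xs a f) (*-comm a (∑ xs f)))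

  ∑-++ : ∀ (xs ys : List A) f → ∑ (xs ++ ys) f ≈ ∑ xs f + ∑ ys f
  ∑-++ []       ys f = sym (+-identityˡ (∑ ys f))
  ∑-++ (x ∷ xs) ys f = trans (+-congˡ (∑-++ xs ys f)) (sym (+-assoc (f x) (∑ xs f) (∑ ys f)))

  ∑-swap : ∀ (xs : List A) (ys : List B) (f : A → B → Carrier) →
    ∑ xs (λ x → ∑ ys (f x)) ≈ ∑ ys (λ y → ∑ xs (λ x → f x y))
  ∑-swap []       ys f = sym (∑-zero ys (λ _ → refl))
  ∑-swap (x ∷ xs) ys f = trans (+-congˡ (∑-swap xs ys f)) (sym (∑-+ ys (f x) (λ y → ∑ xs (λ z → f z y))))

  -- Associativity of the product of a row vector, a matrix and a column vector: expand both inner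
  -- sums and exchange their order.
  ∑-assoc : ∀ (xs : List A) (ys : List B) (f : A → Carrier) (a : A → B → Carrier) (g : B → Carrier) →
    ∑ xs (λ x → f x * ∑ ys (λ y → a x y * g y)) ≈ ∑ ys (λ y → ∑ xs (λ x → f x * a x y) * g y)
  ∑-assoc xs ys f a g = begin
    ∑ xs (λ x → f x * ∑ ys (λ y → a x y * g y))
      ≈⟨ ∑-cong xs (λ x → sym (∑-*ˡ ys (f x) (λ y → a x y * g y))) ⟩
    ∑ xs (λ x → ∑ ys (λ y → f x * (a x y * g y)))
      ≈⟨ ∑-swap xs ys (λ x y → f x * (a x y * g y)) ⟩
    ∑ ys (λ y → ∑ xs (λ x → f x * (a x y * g y)))
      ≈⟨ ∑-cong ys (λ y → trans (∑-cong xs (λ x → sym (*-assoc (f x) (a x y) (g y))))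
                                (∑-*ʳ xs (g y) (λ x → f x * a x y))) ⟩
    ∑ ys (λ y → ∑ xs (λ x → f x * a x y) * g y) ∎

  ∑-map : ∀ (h : A → B) xs f → ∑ (List.map h xs) f ≡ ∑ xs (f ∘ h)
  ∑-map h []       f = ≡.refl
  ∑-map h (x ∷ xs) f = ≡.cong (f (h x) +_) (∑-map h xs f)

  ∑-mapMaybe : ∀ (h : A → Maybe B) xs f →
    ∑ (mapMaybe h xs) f ≈ ∑ xs (maybe f 0# ∘ h)
  ∑-mapMaybe h []       f = refl
  ∑-mapMaybe h (x ∷ xs) f with h x
  ... | just y  = +-congˡ (∑-mapMaybe h xs f)
  ... | nothing = trans (∑-mapMaybe h xs f) (sym (+-identityˡ _))

  -- The list has no repetitions and contains every element.
  Exhaustive : List A → Set _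
  Exhaustive {A} xs = ∀ (f : A → Carrier) w → (∀ x → x ≢ w → f x ≈ 0#) → ∑ xs f ≈ f w

  module _ {A : Set} (xs : List A) (exhaustive : Exhaustive xs) (_≟_ : DecidableEquality A) where

    ∑-δ : ∀ (f : A → Carrier) w → ∑ xs (λ x → f x * 𝟙 (x ≟ w)) ≈ f w
    ∑-δ f w = begin
      ∑ xs (λ x → f x * 𝟙 (x ≟ w))
        ≈⟨ exhaustive _ w (λ x x≢w → trans (*-congˡ (reflexive (𝟙-false (x ≟ w) x≢w))) (zeroʳ (f x))) ⟩
      f w * 𝟙 (w ≟ w) ≈⟨ *-congˡ (reflexive (𝟙-true (w ≟ w) ≡.refl)) ⟩
      f w * 1#        ≈⟨ *-identityʳ (f w) ⟩
      f w             ∎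

  subsets-exhaustive : ∀ n → Exhaustive (subsets n)
  subsets-exhaustive zero    f [] f≈0 = +-identityʳ (f [])
  subsets-exhaustive (suc n) f (b ∷ W) f≈0 =
    trans (∑-++ (List.map (outside ∷_) (subsets n)) (List.map (inside ∷_) (subsets n)) f)
    (trans (+-cong (reflexive (∑-map (outside ∷_) (subsets n) f))
                   (reflexive (∑-map (inside ∷_) (subsets n) f)))
    (one-half b f≈0))
    where
    one-half : ∀ b → (∀ U → U ≢ b ∷ W → f U ≈ 0#) →
      ∑ (subsets n) (f ∘ (outside ∷_)) + ∑ (subsets n) (f ∘ (inside ∷_)) ≈ f (b ∷ W)
    one-half outside f≈0 =
      trans (+-cong
        (subsets-exhaustive n (f ∘ (outside ∷_)) W (λ U U≢W → f≈0 (outside ∷ U) (U≢W ∘ Vec.∷-injectiveʳ)))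
        (∑-zero (subsets n) (λ U → f≈0 (inside ∷ U) λ ())))
      (+-identityʳ _)
    one-half inside f≈0 =
      trans (+-cong
        (∑-zero (subsets n) (λ U → f≈0 (outside ∷ U) λ ()))
        (subsets-exhaustive n (f ∘ (inside ∷_)) W (λ U U≢W → f≈0 (inside ∷ U) (U≢W ∘ Vec.∷-injectiveʳ))))
      (+-identityˡ _)

  -- Through `maybe f 0#` the sum becomes one over all point sets: those that `select` rejects
  -- contribute zero, and those that it accepts are told apart by `value`.
  subspaces-exhaustive : ∀ V k → Exhaustive (subspaces V k)
  subspaces-exhaustive V k f W f≈0 =
    trans (∑-mapMaybe (select V k) (subsets (size V)) f)
    (trans (subsets-exhaustive (size V) _ (value W) outside-W)
    (reflexive (≡.cong (maybe f 0#) (select-yes V k W))))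
    where
    outside-W : ∀ U → U ≢ value W → maybe f 0# (select V k U) ≈ 0#
    outside-W U U≢W with select V k U in eq
    ... | nothing = refl
    ... | just K  = f≈0 K (λ K≡W → U≢W (≡.trans (≡.sym (select-just V k U eq)) (≡.cong value K≡W)))

  ∑-allFin : ∀ n (f : Fin (suc n) → Carrier) →
    ∑ (allFin (suc n)) f ≡ f Fin.zero + ∑ (allFin n) (f ∘ Fin.suc)
  ∑-allFin n f = ≡.cong (f Fin.zero +_)
    (≡.trans (≡.cong (λ xs → ∑ xs f) (≡.sym (List.map-tabulate (λ i → i) Fin.suc)))
             (∑-map Fin.suc (allFin n) f))

  allFin-exhaustive : ∀ n → Exhaustive (allFin n)
  allFin-exhaustive (suc n) f Fin.zero f≈0 =
    trans (reflexive (∑-allFin n f))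
    (trans (+-congˡ (∑-zero (allFin n) (λ i → f≈0 (Fin.suc i) λ ()))) (+-identityʳ _))
  allFin-exhaustive (suc n) f (Fin.suc w) f≈0 =
    trans (reflexive (∑-allFin n f))
    (trans (+-cong (f≈0 Fin.zero λ ())
      (allFin-exhaustive n (f ∘ Fin.suc) w (λ i i≢w → f≈0 (Fin.suc i) (i≢w ∘ Fin.suc-injective))))
    (+-identityˡ _))

value-injective : ∀ {V k} {K L : Subspace V k} → value K ≡ value L → K ≡ L
value-injective ≡.refl = ≡.refl

infix 4 _≟ˢ_
_≟ˢ_ : ∀ {V k} → DecidableEquality (Subspace V k)
(U , p) ≟ˢ (W , r) = map′ value-injective (≡.cong value) (Vec.≡-dec Bool._≟_ U W)

module ∑ᶻ = ListSum ℤ.+-*-commutativeSemiring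
module ∑ᴺ = ListSum ℕ.+-*-commutativeSemiring

module _ {c₁ ℓ₁ c₂ ℓ₂} (R : CommutativeSemiring c₁ ℓ₁) (S : CommutativeSemiring c₂ ℓ₂) where
  private
    module R = CommutativeSemiring R
    module S = CommutativeSemiring S
    module ∑R = ListSum R
    module ∑S = ListSum S

  ∑-homo : ∀ (h : R.Carrier → S.Carrier) → (∀ a b → h (a R.+ b) S.≈ h a S.+ h b) → h R.0# S.≈ S.0# →
    ∀ {A : Set} (xs : List A) f → h (∑R.∑ xs f) S.≈ ∑S.∑ xs (h ∘ f)
  ∑-homo h h-+ h-0 []       f = h-0
  ∑-homo h h-+ h-0 (x ∷ xs) f = S.trans (h-+ (f x) (∑R.∑ xs f)) (S.+-congˡ (∑-homo h h-+ h-0 xs f))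

-- Gaussian binomial coefficients and the number of superspaces

-- The q-analogue [m] = 1 + q + ... + q^(m-1), in Horner form.
qNumber : ℕ → ℕ → ℕ
qNumber q zero    = 0
qNumber q (suc m) = 1 ℕ.+ q ℕ.* qNumber q m

-- Unfold Pascal's recursion on the left and write [j+1] as 1 + q [j]. The induction hypotheses then
-- yield [m] times the two terms of the recursion one level down, and these recombine. The double
-- count of superspaces leads to exactly this relation.
gaussian-absorption : ∀ q m j →
  gaussian q (suc m) (suc j) ℕ.* qNumber q (suc j) ≡ qNumber q (suc m) ℕ.* gaussian q m j
gaussian-absorption q zero zero =
  solve 1 (λ q → (con 1 :+ q :* con 1 :* con 0) :* (con 1 :+ q :* con 0) :=
                 (con 1 :+ q :* con 0) :* con 1) ≡.refl q
  where open ℕ-Solver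
gaussian-absorption q zero (suc j) =
  solve 3 (λ p b q → (con 0 :+ p :* con 0) :* b := (con 1 :+ q :* con 0) :* con 0) ≡.refl
    (q ℕ.^ suc (suc j)) (qNumber q (suc (suc j))) q
  where open ℕ-Solver
gaussian-absorption q (suc m) zero = begin
  (1 ℕ.+ q ℕ.^ 1 ℕ.* X) ℕ.* qNumber q 1
    ≡⟨ solve 3 (λ q x b → (con 1 :+ (q :* con 1) :* x) :* b := b :+ q :* (x :* b)) ≡.refl q X (qNumber q 1) ⟩
  qNumber q 1 ℕ.+ q ℕ.* (X ℕ.* qNumber q 1)
    ≡⟨ ≡.cong (λ r → qNumber q 1 ℕ.+ q ℕ.* r) (gaussian-absorption q m zero) ⟩
  qNumber q 1 ℕ.+ q ℕ.* (qNumber q (suc m) ℕ.* 1)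
    ≡⟨ solve 2 (λ q c → (con 1 :+ q :* con 0) :+ q :* (c :* con 1) := (con 1 :+ q :* c) :* con 1)
         ≡.refl q (qNumber q (suc m)) ⟩
  qNumber q (suc (suc m)) ℕ.* 1 ∎
  where
  open ≡.≡-Reasoning
  open ℕ-Solver
  X = gaussian q (suc m) 1
gaussian-absorption q (suc m) (suc j) = begin
  (a ℕ.+ q ℕ.* p ℕ.* X) ℕ.* (1 ℕ.+ q ℕ.* b)
    ≡⟨ solve 5 (λ q p a x b → (a :+ q :* p :* x) :* (con 1 :+ q :* b) :=
                 a :+ q :* (a :* b) :+ q :* p :* (x :* (con 1 :+ q :* b))) ≡.refl q p a X b ⟩
  a ℕ.+ q ℕ.* (a ℕ.* b) ℕ.+ q ℕ.* p ℕ.* (X ℕ.* (1 ℕ.+ q ℕ.* b))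
    ≡⟨ ≡.cong₂ (λ r s → a ℕ.+ q ℕ.* r ℕ.+ q ℕ.* p ℕ.* s)
         (gaussian-absorption q m j) (gaussian-absorption q m (suc j)) ⟩
  a ℕ.+ q ℕ.* (c ℕ.* e) ℕ.+ q ℕ.* p ℕ.* (c ℕ.* d)
    ≡⟨ solve 5 (λ q p c d e → (e :+ p :* d) :+ q :* (c :* e) :+ q :* p :* (c :* d) :=
                 (con 1 :+ q :* c) :* (e :+ p :* d)) ≡.refl q p c d e ⟩
  (1 ℕ.+ q ℕ.* c) ℕ.* a ∎
  where
  open ≡.≡-Reasoning
  open ℕ-Solver
  p = q ℕ.^ suc j
  a = gaussian q (suc m) (suc j)
  X = gaussian q (suc m) (suc (suc j))
  b = qNumber q (suc j)
  c = qNumber q (suc m)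
  d = gaussian q m (suc j)
  e = gaussian q m j

-- The geometric series; with the base written `suc p`, the factor q - 1 needs no truncated
-- subtraction.
^-qNumber : ∀ p m → suc p ℕ.^ m ≡ 1 ℕ.+ p ℕ.* qNumber (suc p) m
^-qNumber p zero    = ≡.cong suc (≡.sym (ℕ.*-zeroʳ p))
^-qNumber p (suc m) = ≡.trans (≡.cong (suc p ℕ.*_) (^-qNumber p m))
  (solve 2 (λ p b → (con 1 :+ p) :* (con 1 :+ p :* b) := con 1 :+ p :* (con 1 :+ (con 1 :+ p) :* b))
    ≡.refl p (qNumber (suc p) m))
  where open ℕ-Solver

-- Cardinalities of finite subsets as sums of indicators

module _ where

  open ∑ᴺ

  ∑-∈ : ∀ {n} (U : Subset n) → ∑ (allFin n) (λ i → 𝟙 (i Subset.∈? U)) ≡ ∣ U ∣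
  ∑-∈ []            = ≡.refl
  ∑-∈ {suc n} (s ∷ U) = ≡.trans (∑-allFin n (λ i → 𝟙 (i Subset.∈? (s ∷ U)))) (head s)
    where
    head : ∀ s → 𝟙 (Fin.zero Subset.∈? (s ∷ U)) ℕ.+ ∑ (allFin n) (λ i → 𝟙 (i Subset.∈? U)) ≡ ∣ s ∷ U ∣
    head inside  = ≡.cong suc (∑-∈ U)
    head outside = ∑-∈ U

  ∑-1 : ∀ n → ∑ (allFin n) (λ _ → 1) ≡ n
  ∑-1 zero    = ≡.refl
  ∑-1 (suc n) = ≡.trans (∑-allFin n (λ _ → 1)) (≡.cong suc (∑-1 n))

  -- Double counting of the graph of `g`: every `c` has one image, and every `i` in `U` has exactly
  -- one preimage.
  card-image : ∀ {m n} (U : Subset n) (g : Fin m → Fin n) → (∀ {c d} → g c ≡ g d → c ≡ d) →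
    (∀ c → g c ∈ U) → (∀ {i} → i ∈ U → ∃ λ c → g c ≡ i) → ∣ U ∣ ≡ m
  card-image {m} {n} U g g-injective g∈U onto = begin
    ∣ U ∣                                               ≡⟨ ∑-∈ U ⟨
    ∑ (allFin n) (λ i → 𝟙 (i Subset.∈? U))              ≡⟨ ∑-cong (allFin n) fibre ⟩
    ∑ (allFin n) (λ i → ∑ (allFin m) (λ c → 𝟙 (g c Fin.≟ i)))
      ≡⟨ ∑-swap (allFin n) (allFin m) (λ i c → 𝟙 (g c Fin.≟ i)) ⟩
    ∑ (allFin m) (λ c → ∑ (allFin n) (λ i → 𝟙 (g c Fin.≟ i)))
      ≡⟨ ∑-cong (allFin m) (λ c →
           ≡.trans (allFin-exhaustive n _ (g c) (λ i i≢gc → 𝟙-false (g c Fin.≟ i) (i≢gc ∘ ≡.sym)))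
                   (𝟙-true (g c Fin.≟ g c) ≡.refl)) ⟩
    ∑ (allFin m) (λ _ → 1)                              ≡⟨ ∑-1 m ⟩
    m                                                   ∎
    where
    open ≡.≡-Reasoning
    fibre : ∀ i → 𝟙 (i Subset.∈? U) ≡ ∑ (allFin m) (λ c → 𝟙 (g c Fin.≟ i))
    fibre i with i Subset.∈? U
    ... | no i∉U = ≡.sym (∑-zero (allFin m) (λ c → 𝟙-false (g c Fin.≟ i) (λ { ≡.refl → i∉U (g∈U c) })))
    ... | yes i∈U with onto i∈U
    ... | c , ≡.refl = ≡.sym (≡.trans
      (allFin-exhaustive m _ c (λ d d≢c → 𝟙-false (g d Fin.≟ g c) (d≢c ∘ g-injective)))
      (𝟙-true (g c Fin.≟ g c) ≡.refl))

  ∑-∉ : ∀ {n} (T U : Subset n) → T ⊆ U →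
    ∣ T ∣ ℕ.+ ∑ (allFin n) (λ i → 𝟙 (¬? (i Subset.∈? T)) ℕ.* 𝟙 (i Subset.∈? U)) ≡ ∣ U ∣
  ∑-∉ {n} T U T⊆U = begin
    ∣ T ∣ ℕ.+ ∑ (allFin n) out                               ≡⟨ ≡.cong (ℕ._+ ∑ (allFin n) out) (∑-∈ T) ⟨
    ∑ (allFin n) (λ i → 𝟙 (i Subset.∈? T)) ℕ.+ ∑ (allFin n) out
      ≡⟨ ∑-+ (allFin n) (λ i → 𝟙 (i Subset.∈? T)) out ⟨
    ∑ (allFin n) (λ i → 𝟙 (i Subset.∈? T) ℕ.+ out i)         ≡⟨ ∑-cong (allFin n) split ⟩
    ∑ (allFin n) (λ i → 𝟙 (i Subset.∈? U))                   ≡⟨ ∑-∈ U ⟩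
    ∣ U ∣                                                    ∎
    where
    open ≡.≡-Reasoning
    out : Fin n → ℕ
    out i = 𝟙 (¬? (i Subset.∈? T)) ℕ.* 𝟙 (i Subset.∈? U)
    split : ∀ i → 𝟙 (i Subset.∈? T) ℕ.+ out i ≡ 𝟙 (i Subset.∈? U)
    split i with i Subset.∈? T
    ... | yes i∈T = ≡.sym (𝟙-true (i Subset.∈? U) (T⊆U i∈T))
    ... | no  _   = ℕ.*-identityˡ (𝟙 (i Subset.∈? U))

card-∪⁅⁆ : ∀ {n} (U : Subset n) {i} → i ∉ U → ∣ U ∪ ⁅ i ⁆ ∣ ≡ suc ∣ U ∣
card-∪⁅⁆ (inside  ∷ U) {Fin.zero}  i∉U = ⊥-elim (i∉U here)
card-∪⁅⁆ (outside ∷ U) {Fin.zero}  i∉U = ≡.cong (suc ∘ ∣_∣) (Subset.∪-identityʳ U)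
card-∪⁅⁆ (inside  ∷ U) {Fin.suc i} i∉U = ≡.cong suc (card-∪⁅⁆ U (i∉U ∘ there))
card-∪⁅⁆ (outside ∷ U) {Fin.suc i} i∉U = card-∪⁅⁆ U (i∉U ∘ there)

⊆∧∣∣≡⇒≡ : ∀ {n} (U W : Subset n) → U ⊆ W → ∣ U ∣ ≡ ∣ W ∣ → U ≡ W
⊆∧∣∣≡⇒≡ U W U⊆W eq = Subset.⊆-antisym U⊆W λ {i} i∈W → case i i∈W (i Subset.∈? U)
  where
  case : ∀ i → i ∈ W → Dec (i ∈ U) → i ∈ U
  case i i∈W (yes i∈U) = i∈U
  case i i∈W (no  i∉U) = ⊥-elim (ℕ.<⇒≢ (Subset.p⊂q⇒∣p∣<∣q∣ (U⊆W , i , i∈W , i∉U)) eq)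

fromPred : ∀ {n} {P : Pred (Fin n) 0ℓ} → Decidable P → Subset n
fromPred P? = Vec.tabulate (does ∘ P?)

∈-fromPred : ∀ {n} {P : Pred (Fin n) 0ℓ} (P? : Decidable P) i → i ∈ fromPred P? ⇔ P i
∈-fromPred {P = P} P? i = mk⇔
  (λ i∈ → holds (P? i) (≡.trans (≡.sym (Vec.lookup∘tabulate (does ∘ P?) i)) (Vec.[]=⇒lookup i∈)))
  (λ p → Vec.lookup⇒[]= i (fromPred P?) (≡.trans (Vec.lookup∘tabulate (does ∘ P?) i) (dec-true (P? i) p)))
  where
  holds : (p? : Dec (P i)) → does p? ≡ inside → P i
  holds (yes p) _ = p

-- Adjoining a vector to a linear subspace

module Extension (F : FiniteField) (V : VectorSpaceOver F) where
  open FiniteField F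
  open LeftModule V
  open LinearAlgebra F V
  open SetoidReasoning ≈ᴹ-setoid

  +-*-inverse : ∀ a v → a *ₗ v +ᴹ (- a) *ₗ v ≈ᴹ 0ᴹ
  +-*-inverse a v = begin
    a *ₗ v +ᴹ (- a) *ₗ v  ≈⟨ *ₗ-distribʳ v a (- a) ⟨
    (a + - a) *ₗ v        ≈⟨ *ₗ-congʳ (-‿inverseʳ a) ⟩
    0# *ₗ v               ≈⟨ *ₗ-zeroˡ v ⟩
    0ᴹ                    ∎

  cancel-* : ∀ a u v → (u +ᴹ a *ₗ v) +ᴹ (- a) *ₗ v ≈ᴹ u
  cancel-* a u v = begin
    (u +ᴹ a *ₗ v) +ᴹ (- a) *ₗ v  ≈⟨ +ᴹ-assoc u (a *ₗ v) ((- a) *ₗ v) ⟩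
    u +ᴹ (a *ₗ v +ᴹ (- a) *ₗ v)  ≈⟨ +ᴹ-congˡ (+-*-inverse a v) ⟩
    u +ᴹ 0ᴹ                      ≈⟨ +ᴹ-identityʳ u ⟩
    u                            ∎

  module _ {W : Pred Carrierᴹ 0ℓ} (resp : ∀ {u v} → u ≈ᴹ v → W u → W v)
           (subspace : IsLinearSubspace W) where

    private
      W-0 = proj₁ subspace
      W-+ = proj₁ (proj₂ subspace)
      W-* = proj₂ (proj₂ subspace)

    combination-closed : ∀ {m} a (b : Vector.Vector Carrierᴹ m) → (∀ i → W (b i)) → W (combination a b)
    combination-closed {zero}  a b b∈W = W-0
    combination-closed {suc m} a b b∈W =
      W-+ _ _ (W-* _ _ (b∈W Fin.zero)) (combination-closed (a ∘ Fin.suc) (b ∘ Fin.suc) (b∈W ∘ Fin.suc))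

    module _ (v : Carrierᴹ) where

      -- The sum of `W` and the span of `v`. Only the scalar is quantified, since it determines the
      -- component in `W`; membership can therefore be decided by running through the field.
      Adjoin : Pred Carrierᴹ 0ℓ
      Adjoin u = ∃ λ a → W (u +ᴹ a *ₗ v)

      adjoin-resp : ∀ {u w} → u ≈ᴹ w → Adjoin u → Adjoin w
      adjoin-resp u≈w (a , p) = a , resp (+ᴹ-congʳ u≈w) p

      adjoin-contains : ∀ u → W u → Adjoin u
      adjoin-contains u Wu = 0# , resp (≈ᴹ-sym (≈ᴹ-trans (+ᴹ-congˡ (*ₗ-zeroˡ v)) (+ᴹ-identityʳ u))) Wu

      adjoin-contains-generator : Adjoin v
      adjoin-contains-generator = - 1# , resp (≈ᴹ-sym (begin
        v +ᴹ (- 1#) *ₗ v        ≈⟨ +ᴹ-congʳ (*ₗ-identityˡ v) ⟨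
        1# *ₗ v +ᴹ (- 1#) *ₗ v  ≈⟨ +-*-inverse 1# v ⟩
        0ᴹ                      ∎)) W-0

      adjoin-least : ∀ {K : Pred Carrierᴹ 0ℓ} → (∀ {u v} → u ≈ᴹ v → K u → K v) → IsLinearSubspace K →
        (∀ u → W u → K u) → K v → ∀ u → Adjoin u → K u
      adjoin-least K-resp (_ , K-+ , K-*) W⊆K Kv u (a , p) =
        K-resp (cancel-* a u v) (K-+ _ _ (W⊆K _ p) (K-* (- a) v Kv))

      adjoin-isLinearSubspace : IsLinearSubspace Adjoin
      adjoin-isLinearSubspace =
          adjoin-contains 0ᴹ W-0
        , (λ u w (a , p) (c , r) → a + c , resp (begin
            (u +ᴹ a *ₗ v) +ᴹ (w +ᴹ c *ₗ v)  ≈⟨ interchange u (a *ₗ v) w (c *ₗ v) ⟩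
            (u +ᴹ w) +ᴹ (a *ₗ v +ᴹ c *ₗ v)  ≈⟨ +ᴹ-congˡ (*ₗ-distribʳ v a c) ⟨
            (u +ᴹ w) +ᴹ (a + c) *ₗ v        ∎) (W-+ _ _ p r))
        , (λ c u (a , p) → c * a , resp (begin
            c *ₗ (u +ᴹ a *ₗ v)              ≈⟨ *ₗ-distribˡ c u (a *ₗ v) ⟩
            c *ₗ u +ᴹ c *ₗ (a *ₗ v)         ≈⟨ +ᴹ-congˡ (*ₗ-assoc c a v) ⟨
            c *ₗ u +ᴹ (c * a) *ₗ v          ∎) (W-* c _ p))
        where
        open CommutativeSemigroupProperties (CommutativeMonoid.commutativeSemigroup +ᴹ-commutativeMonoid)
          using (interchange)

      adjoin-basis : ∀ {m} {b : Vector.Vector Carrierᴹ m} → ¬ W v →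
        IsBasisOf W b → IsBasisOf Adjoin (v Vector.∷ b)
      adjoin-basis {m} {b} v∉W (b∈W , independent , spanning) = members , independent⁺ , spanning⁺
        where
        members : ∀ i → Adjoin ((v Vector.∷ b) i)
        members Fin.zero    = adjoin-contains-generator
        members (Fin.suc i) = adjoin-contains (b i) (b∈W i)

        -- If the leading coefficient had an inverse `c`, then `v` would be `- c` times the
        -- combination of the other vectors, hence in `W`.
        leading-zero : ∀ a → combination a (v Vector.∷ b) ≈ᴹ 0ᴹ → a Fin.zero ≈ 0#
        leading-zero a eq with ≈-dec enumeration (a Fin.zero) 0#
        ... | yes a₀≈0 = a₀≈0
        ... | no  a₀≉0 = let (c , a₀c≈1) = invertible (a Fin.zero) a₀≉0
                             w = combination (a ∘ Fin.suc) b in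
          ⊥-elim (v∉W (resp (begin
            (- c) *ₗ w                                        ≈⟨ +ᴹ-identityˡ ((- c) *ₗ w) ⟨
            0ᴹ +ᴹ (- c) *ₗ w                                  ≈⟨ +ᴹ-congʳ (*ₗ-zeroʳ c) ⟨
            c *ₗ 0ᴹ +ᴹ (- c) *ₗ w                             ≈⟨ +ᴹ-congʳ (*ₗ-congˡ eq) ⟨
            c *ₗ (a Fin.zero *ₗ v +ᴹ w) +ᴹ (- c) *ₗ w
              ≈⟨ +ᴹ-congʳ (*ₗ-distribˡ c (a Fin.zero *ₗ v) w) ⟩
            (c *ₗ (a Fin.zero *ₗ v) +ᴹ c *ₗ w) +ᴹ (- c) *ₗ w  ≈⟨ cancel-* c _ w ⟩
            c *ₗ (a Fin.zero *ₗ v)                            ≈⟨ *ₗ-assoc c (a Fin.zero) v ⟨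
            (c * a Fin.zero) *ₗ v
              ≈⟨ *ₗ-congʳ (trans (*-comm c (a Fin.zero)) a₀c≈1) ⟩
            1# *ₗ v                                           ≈⟨ *ₗ-identityˡ v ⟩
            v                                                 ∎)
            (W-* (- c) w (combination-closed (a ∘ Fin.suc) b b∈W))))

        independent⁺ : LinearlyIndependent (v Vector.∷ b)
        independent⁺ a eq Fin.zero    = leading-zero a eq
        independent⁺ a eq (Fin.suc i) = independent (a ∘ Fin.suc) (begin
          combination (a ∘ Fin.suc) b                       ≈⟨ +ᴹ-identityˡ _ ⟨
          0ᴹ +ᴹ combination (a ∘ Fin.suc) b                 ≈⟨ +ᴹ-congʳ (*ₗ-zeroˡ v) ⟨
          0# *ₗ v +ᴹ combination (a ∘ Fin.suc) b            ≈⟨ +ᴹ-congʳ (*ₗ-congʳ (leading-zero a eq)) ⟨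
          a Fin.zero *ₗ v +ᴹ combination (a ∘ Fin.suc) b    ≈⟨ eq ⟩
          0ᴹ                                                ∎) i

        spanning⁺ : ∀ u → Adjoin u → ∃ λ a → combination a (v Vector.∷ b) ≈ᴹ u
        -- It is `u + c v` that lies in `W`, whence the negative coefficient of `v`.
        spanning⁺ u (c , p) = let (a , eq) = spanning _ p in (- c) Vector.∷ a , (begin
          (- c) *ₗ v +ᴹ combination a b       ≈⟨ +ᴹ-comm _ _ ⟩
          combination a b +ᴹ (- c) *ₗ v       ≈⟨ +ᴹ-congʳ eq ⟩
          (u +ᴹ c *ₗ v) +ᴹ (- c) *ₗ v         ≈⟨ cancel-* c u v ⟩
          u                                   ∎)

-- Points of a subspace and subspaces of the next rank

isSubspaceOfRank : ∀ {V k} (K : Subspace V k) → IsSubspace V (value K) × HasRank V (value K) k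
-- The proof stored in a `Subspace` is irrelevant; as the property is decidable, a usable proof can
-- be computed afresh.
isSubspaceOfRank {V} {k} (U , [ p ]) = recompute (isSubspaceOfRank? V k U) p

order>1 : ∀ F → 1 ℕ.< FiniteField.order F
order>1 F = at-least-two (to 0#) (to 1#) λ to0≡to1 →
  0≉1 (trans (sym (inverseʳ ≡.refl)) (trans (from-cong to0≡to1) (inverseʳ ≡.refl)))
  where
  open FiniteField F
  open Inverse enumeration
  at-least-two : ∀ {n} (i j : Fin n) → i ≢ j → 1 ℕ.< n
  at-least-two {suc zero}    Fin.zero Fin.zero i≢j = ⊥-elim (i≢j ≡.refl)
  at-least-two {suc (suc n)} i        j        i≢j = s≤s (s≤s z≤n)

cardinality : Space → ℕ → ℕ
cardinality (finiteSet _ _ _)       k = k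
cardinality (vectorSpace F _ _ _ _) k = FiniteField.order F ℕ.^ k

size≡cardinality : ∀ V → size V ≡ cardinality V (rk V)
size≡cardinality (finiteSet _ _ _)       = ≡.refl
size≡cardinality (vectorSpace F _ _ _ _) = ≡.refl

-- For vector spaces, a basis maps coordinate vectors to points: independence makes the map
-- injective and spanning makes it onto the subspace.
∣value∣ : ∀ V {k} (K : Subspace V k) → ∣ value K ∣ ≡ cardinality V k
∣value∣ V@(finiteSet _ _ _) K = proj₂ (isSubspaceOfRank {V} K)
∣value∣ V@(vectorSpace F W n B basis) {k} K =
  let (subspace , b , b∈U , independent , spanning) = isSubspaceOfRank {V} K in
  card-image (value K) (λ c → to (combination (Scalars.from c) b))
    (λ {c} {d} eq → ≡.trans (≡.sym (Scalars.inverseˡ (Setoid.refl (VectorEquality.≋-setoid setoid k))))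
      (≡.trans (Scalars.to-cong (combination-injective independent (to-injective eq)))
               (Scalars.inverseˡ (Setoid.refl (VectorEquality.≋-setoid setoid k)))))
    (λ c → Extension.combination-closed F W respects subspace (Scalars.from c) b b∈U)
    (λ {i} i∈U →
      let (a , eq) = spanning (from i) (≡.subst (_∈ value K) (≡.sym (inverseˡ ≈ᴹ-refl)) i∈U) in
      Scalars.to a ,
      ≡.trans (to-cong (≈ᴹ-trans (combination-cong (Scalars.inverseʳ ≡.refl) (λ _ → ≈ᴹ-refl)) eq))
              (inverseˡ ≈ᴹ-refl))
  where
  open FiniteField F
  open LeftModule W
  open LinearAlgebra F W
  open Inverse (enumerate V)
  module Scalars = Inverse (tuples enumeration k)
  respects : ∀ {u v} → u ≈ᴹ v → to u ∈ value K → to v ∈ value K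
  respects u≈v = ≡.subst (_∈ value K) (to-cong u≈v)
  to-injective : ∀ {u v} → to u ≡ to v → u ≈ᴹ v
  to-injective eq = ≈ᴹ-trans (≈ᴹ-sym (inverseʳ ≡.refl)) (≈ᴹ-trans (from-cong eq) (inverseʳ ≡.refl))

-- The induction step of the superspace count: asking `K` to contain one more point amounts to
-- replacing `T` by a subspace of the next rank. It is a union with a singleton for sets, and
-- `Adjoin` turned into a point set for vector spaces.
adjoin : ∀ V {t} (T : Subspace V t) {i} → i ∉ value T → ∃ λ (T⁺ : Subspace V (suc t)) →
  ∀ {k} (K : Subspace V k) → value T⁺ ⊆ value K ⇔ (value T ⊆ value K × i ∈ value K)
adjoin V@(finiteSet _ _ _) T {i} i∉T =
  (value T ∪ ⁅ i ⁆ , [ tt , ≡.trans (card-∪⁅⁆ (value T) i∉T) (≡.cong suc (∣value∣ V T)) ]) , λ K → mk⇔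
    (λ T⁺⊆K → (λ x∈T → T⁺⊆K (Subset.p⊆p∪q ⁅ i ⁆ x∈T)) , T⁺⊆K (Subset.q⊆p∪q (value T) ⁅ i ⁆ (Subset.x∈⁅x⁆ i)))
    (λ (T⊆K , i∈K) x∈T⁺ → least T⊆K i∈K (Subset.x∈p∪q⁻ (value T) ⁅ i ⁆ x∈T⁺))
  where
  least : ∀ {U} → value T ⊆ U → i ∈ U → ∀ {x} → x ∈ value T ⊎ x ∈ ⁅ i ⁆ → x ∈ U
  least T⊆U i∈U (inj₁ x∈T) = T⊆U x∈T
  least {U} T⊆U i∈U (inj₂ x∈i) = ≡.subst (_∈ U) (≡.sym (Subset.x∈⁅y⁆⇒x≡y i x∈i)) i∈U
adjoin V@(vectorSpace F W n B basis) {t} T {i} i∉T =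
  (U⁺ , [ transport-subspace , v Vector.∷ b , transport-basis ]) , λ K → mk⇔
    (λ T⁺⊆K → (λ {x} x∈T → T⁺⊆K (∈U⁺.from x (adjoin-contains respects subspace v (from x) (from∈ x∈T))))
            , T⁺⊆K (∈U⁺.from i (adjoin-contains-generator respects subspace v)))
    (λ (T⊆K , i∈K) {x} x∈T⁺ → ∈from⇒∈ {value K}
      (adjoin-least respects subspace v (respectsᵁ {value K}) (proj₁ (isSubspaceOfRank {V} K))
        (λ u u∈T → T⊆K u∈T) (from∈ {value K} i∈K) (from x) (∈U⁺.to x x∈T⁺)))
  where
  open FiniteField F using (enumeration; Carrier)
  open LeftModule W
  open LinearAlgebra F W
  open Extension F W
  open Inverse (enumerate V)
  respectsᵁ : ∀ {U} {u v} → u ≈ᴹ v → to u ∈ U → to v ∈ U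
  respectsᵁ {U} u≈v = ≡.subst (_∈ U) (to-cong u≈v)
  respects : ∀ {u v} → u ≈ᴹ v → to u ∈ value T → to v ∈ value T
  respects = respectsᵁ {value T}
  from∈ : ∀ {U x} → x ∈ U → to (from x) ∈ U
  from∈ {U} = ≡.subst (_∈ U) (≡.sym (inverseˡ ≈ᴹ-refl))
  ∈from⇒∈ : ∀ {U x} → to (from x) ∈ U → x ∈ U
  ∈from⇒∈ {U} = ≡.subst (_∈ U) (inverseˡ ≈ᴹ-refl)
  subspace = proj₁ (isSubspaceOfRank {V} T)
  b = proj₁ (proj₂ (isSubspaceOfRank {V} T))
  v = from i
  Adjoin? : ∀ u → Dec (Adjoin respects subspace v u)
  Adjoin? u = ∃-dec enumeration
    (λ a≈c → respects (+ᴹ-congˡ (*ₗ-congʳ a≈c))) (λ a → to (u +ᴹ a *ₗ v) Subset.∈? value T)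
  U⁺ : Subset (size V)
  U⁺ = fromPred (Adjoin? ∘ from)
  module ∈U⁺ x = Equivalence (∈-fromPred (Adjoin? ∘ from) x)
  to-U⁺ : ∀ {u} → to u ∈ U⁺ → Adjoin respects subspace v u
  to-U⁺ p = adjoin-resp respects subspace v (inverseʳ ≡.refl) (∈U⁺.to _ p)
  from-U⁺ : ∀ {u} → Adjoin respects subspace v u → to u ∈ U⁺
  from-U⁺ p = ∈U⁺.from _ (adjoin-resp respects subspace v (≈ᴹ-sym (inverseʳ ≡.refl)) p)
  transport-subspace : IsLinearSubspace (λ u → to u ∈ U⁺)
  transport-subspace = let (U-0 , U-+ , U-*) = adjoin-isLinearSubspace respects subspace v in
    from-U⁺ U-0 , (λ u w p r → from-U⁺ (U-+ u w (to-U⁺ p) (to-U⁺ r))) , (λ a u p → from-U⁺ (U-* a u (to-U⁺ p)))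
  transport-basis : IsBasisOf (λ u → to u ∈ U⁺) (v Vector.∷ b)
  transport-basis =
    let (members , independent , spanning) = adjoin-basis respects subspace v
          (λ v∈T → i∉T (∈from⇒∈ {value T} v∈T)) (proj₂ (proj₂ (isSubspaceOfRank {V} T)))
    in (λ j → from-U⁺ (members j)) , independent , (λ u p → spanning u (to-U⁺ p))

-- The increase of `cardinality` from rank `t` to rank `t + 1`. This factor lets sets and vector
-- spaces share the formula `cardinality-+`.
weight : Space → ℕ → ℕ
weight (finiteSet _ _ _)       t = 1
weight (vectorSpace F _ _ _ _) t = FiniteField.order F ℕ.^ t ℕ.* ℕ.pred (FiniteField.order F)

weight-nonZero : ∀ V t → NonZero (weight V t)
weight-nonZero (finiteSet _ _ _)       t = _
weight-nonZero (vectorSpace F _ _ _ _) t = nonZero (order>1 F)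
  where
  nonZero : ∀ {q} → 1 ℕ.< q → NonZero (q ℕ.^ t ℕ.* ℕ.pred q)
  nonZero {suc (suc p)} _ = ℕ.m*n≢0 (suc (suc p) ℕ.^ t) (suc p) {{ℕ.m^n≢0 (suc (suc p)) t}}
  nonZero {suc zero} (s≤s ())

-- For vector spaces this rests on q^t (q^j - 1) = q^t (q - 1) [j]; for sets, [j] at q = 1 is `j`
-- itself.
cardinality-+ : ∀ V t j → cardinality V (t ℕ.+ j) ≡ cardinality V t ℕ.+ weight V t ℕ.* qNumber (q V) j
cardinality-+ (finiteSet _ _ _) t j =
  ≡.cong (t ℕ.+_) (≡.sym (≡.trans (ℕ.*-identityˡ (qNumber 1 j)) (qNumber-1 j)))
  where
  qNumber-1 : ∀ j → qNumber 1 j ≡ j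
  qNumber-1 zero    = ≡.refl
  qNumber-1 (suc j) = ≡.cong suc (≡.trans (ℕ.*-identityˡ (qNumber 1 j)) (qNumber-1 j))
cardinality-+ (vectorSpace F _ _ _ _) t j = powers (order>1 F)
  where
  powers : ∀ {q} → 1 ℕ.< q → q ℕ.^ (t ℕ.+ j) ≡ q ℕ.^ t ℕ.+ q ℕ.^ t ℕ.* ℕ.pred q ℕ.* qNumber q j
  powers {suc p} _ = begin
    suc p ℕ.^ (t ℕ.+ j)                                    ≡⟨ ℕ.^-distribˡ-+-* (suc p) t j ⟩
    suc p ℕ.^ t ℕ.* suc p ℕ.^ j                            ≡⟨ ≡.cong (suc p ℕ.^ t ℕ.*_) (^-qNumber p j) ⟩
    suc p ℕ.^ t ℕ.* (1 ℕ.+ p ℕ.* qNumber (suc p) j)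
      ≡⟨ solve 3 (λ a p b → a :* (con 1 :+ p :* b) := a :+ a :* p :* b) ≡.refl
           (suc p ℕ.^ t) p (qNumber (suc p) j) ⟩
    suc p ℕ.^ t ℕ.+ suc p ℕ.^ t ℕ.* p ℕ.* qNumber (suc p) j ∎
    where open ≡.≡-Reasoning
          open ℕ-Solver

-- Double counting of superspaces

module _ (V : Space) where
  open ∑ᴺ
  open ≡.≡-Reasoning

  -- Only the number of points of `U` matters, so the formula serves both for a subspace `K` and for
  -- the set of all points, the two sides of the double count.
  outside-points : ∀ {t} (T : Subspace V t) j (U : PointSet V) → value T ⊆ U → ∣ U ∣ ≡ cardinality V (t ℕ.+ j) →
    ∑ (allFin (size V)) (λ i → 𝟙 (¬? (i Subset.∈? value T)) ℕ.* 𝟙 (i Subset.∈? U)) ≡ weight V t ℕ.* qNumber (q V) j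
  outside-points {t} T j U T⊆U ∣U∣≡ = ℕ.+-cancelˡ-≡ (cardinality V t) _ _ (begin
    cardinality V t ℕ.+ out   ≡⟨ ≡.cong (ℕ._+ out) (∣value∣ V T) ⟨
    ∣ value T ∣ ℕ.+ out       ≡⟨ ∑-∉ (value T) U T⊆U ⟩
    ∣ U ∣                     ≡⟨ ∣U∣≡ ⟩
    cardinality V (t ℕ.+ j)   ≡⟨ cardinality-+ V t j ⟩
    cardinality V t ℕ.+ weight V t ℕ.* qNumber (q V) j ∎)
    where
    out : ℕ
    out = ∑ (allFin (size V)) (λ i → 𝟙 (¬? (i Subset.∈? value T)) ℕ.* 𝟙 (i Subset.∈? U))

  count-superspaces : ∀ k {t} → Subspace V t → ℕ
  count-superspaces k T = ∑ (subspaces V k) (λ K → 𝟙 (value T Subset.⊆? value K))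

  -- Counting the pairs (K , v) with T ≤ K and v ∈ K ∖ T by their first and by
  -- their second component gives, for T of rank t,
  -- count k T · w t · [j + 1] = w t · [m + 1] · count k (T + v).
  count-superspaces≡gaussian : ∀ {k} j m {t} (T : Subspace V t) → j ≤ m → t ℕ.+ m ≡ rk V → t ℕ.+ j ≡ k →
    count-superspaces k T ≡ gaussian (q V) m j
  count-superspaces≡gaussian zero m {t} T _ _ eq with ≡.trans (≡.sym eq) (ℕ.+-identityʳ t)
  ... | ≡.refl = ≡.trans
    -- A superspace of `T` of the same rank has as many points as `T`, so it is `T`.
    (subspaces-exhaustive V t (λ K → 𝟙 (value T Subset.⊆? value K)) T (λ K K≢T →
      𝟙-false (value T Subset.⊆? value K) (λ T⊆K → K≢T (≡.sym (value-injective
        (⊆∧∣∣≡⇒≡ (value T) (value K) T⊆K (≡.trans (∣value∣ V T) (≡.sym (∣value∣ V K)))))))))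
    (𝟙-true (value T Subset.⊆? value T) (λ x∈T → x∈T))
  count-superspaces≡gaussian {k} (suc j) (suc m) {t} T (s≤s j≤m) t+m≡n t+j≡k =
    ℕ.*-cancelʳ-≡ _ _ (w ℕ.* qNumber (q V) (suc j)) {{ℕ.m*n≢0 w _ {{weight-nonZero V t}}}} (begin
      count-superspaces k T ℕ.* (w ℕ.* qNumber (q V) (suc j))
        ≡⟨ ∑-*ʳ (subspaces V k) (w ℕ.* qNumber (q V) (suc j)) _ ⟨
      ∑ (subspaces V k) (λ K → 𝟙 (value T Subset.⊆? value K) ℕ.* (w ℕ.* qNumber (q V) (suc j)))
        ≡⟨ ∑-cong (subspaces V k) by-subspace ⟩
      ∑ (subspaces V k) (λ K → ∑ points-of-V (λ i → new i ℕ.* (𝟙 (value T Subset.⊆? value K) ℕ.* 𝟙 (i Subset.∈? value K))))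
        ≡⟨ ∑-swap (subspaces V k) points-of-V
             (λ K i → new i ℕ.* (𝟙 (value T Subset.⊆? value K) ℕ.* 𝟙 (i Subset.∈? value K))) ⟩
      ∑ points-of-V (λ i → ∑ (subspaces V k) (λ K → new i ℕ.* (𝟙 (value T Subset.⊆? value K) ℕ.* 𝟙 (i Subset.∈? value K))))
        ≡⟨ ∑-cong points-of-V by-point ⟩
      ∑ points-of-V (λ i → new i ℕ.* 𝟙 (i Subset.∈? Subset.⊤) ℕ.* gaussian (q V) m j)
        ≡⟨ ∑-*ʳ points-of-V (gaussian (q V) m j) _ ⟩
      ∑ points-of-V (λ i → new i ℕ.* 𝟙 (i Subset.∈? Subset.⊤)) ℕ.* gaussian (q V) m j
        ≡⟨ ≡.cong (ℕ._* gaussian (q V) m j) (outside-points T (suc m) Subset.⊤ (λ _ → Subset.∈⊤) (begin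
             ∣ Subset.⊤ {size V} ∣        ≡⟨ Subset.∣⊤∣≡n (size V) ⟩
             size V                       ≡⟨ size≡cardinality V ⟩
             cardinality V (rk V)         ≡⟨ ≡.cong (cardinality V) t+m≡n ⟨
             cardinality V (t ℕ.+ suc m)  ∎)) ⟩
      w ℕ.* qNumber (q V) (suc m) ℕ.* gaussian (q V) m j
        ≡⟨ ℕ.*-assoc w (qNumber (q V) (suc m)) (gaussian (q V) m j) ⟩
      w ℕ.* (qNumber (q V) (suc m) ℕ.* gaussian (q V) m j)
        ≡⟨ ≡.cong (w ℕ.*_) (gaussian-absorption (q V) m j) ⟨
      w ℕ.* (gaussian (q V) (suc m) (suc j) ℕ.* qNumber (q V) (suc j))
        ≡⟨ solve 3 (λ w g b → w :* (g :* b) := g :* (w :* b)) ≡.refl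
             w (gaussian (q V) (suc m) (suc j)) (qNumber (q V) (suc j)) ⟩
      gaussian (q V) (suc m) (suc j) ℕ.* (w ℕ.* qNumber (q V) (suc j)) ∎)
    where
    open ℕ-Solver using (solve; _:=_; _:*_)
    w : ℕ
    w = weight V t
    points-of-V : List (Fin (size V))
    points-of-V = allFin (size V)
    new : Fin (size V) → ℕ
    new i = 𝟙 (¬? (i Subset.∈? value T))

    by-subspace : ∀ K → 𝟙 (value T Subset.⊆? value K) ℕ.* (w ℕ.* qNumber (q V) (suc j)) ≡
      ∑ points-of-V (λ i → new i ℕ.* (𝟙 (value T Subset.⊆? value K) ℕ.* 𝟙 (i Subset.∈? value K)))
    by-subspace K with value T Subset.⊆? value K
    ... | no _ = ≡.sym (∑-zero points-of-V (λ i → ℕ.*-zeroʳ (new i)))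
    ... | yes T⊆K = begin
      1 ℕ.* (w ℕ.* qNumber (q V) (suc j))   ≡⟨ ℕ.*-identityˡ _ ⟩
      w ℕ.* qNumber (q V) (suc j)
        ≡⟨ outside-points T (suc j) (value K) T⊆K
             (≡.trans (∣value∣ V K) (≡.cong (cardinality V) (≡.sym t+j≡k))) ⟨
      ∑ points-of-V (λ i → new i ℕ.* 𝟙 (i Subset.∈? value K))
        ≡⟨ ∑-cong points-of-V (λ i → ≡.cong (new i ℕ.*_) (≡.sym (ℕ.*-identityˡ _))) ⟩
      ∑ points-of-V (λ i → new i ℕ.* (1 ℕ.* 𝟙 (i Subset.∈? value K))) ∎

    -- The indicator of `Subset.⊤` is always 1; it brings the remaining sum over the points into the
    -- form of `outside-points`.
    by-point : ∀ i →
      ∑ (subspaces V k) (λ K → new i ℕ.* (𝟙 (value T Subset.⊆? value K) ℕ.* 𝟙 (i Subset.∈? value K))) ≡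
      new i ℕ.* 𝟙 (i Subset.∈? Subset.⊤) ℕ.* gaussian (q V) m j
    by-point i with i Subset.∈? value T
    ... | yes _ = ∑-zero (subspaces V k) (λ _ → ≡.refl)
    ... | no i∉T = let (T⁺ , T⁺⊆) = adjoin V T i∉T in begin
      ∑ (subspaces V k) (λ K → 1 ℕ.* (𝟙 (value T Subset.⊆? value K) ℕ.* 𝟙 (i Subset.∈? value K)))
        ≡⟨ ∑-cong (subspaces V k) (λ K → begin
             1 ℕ.* (𝟙 (value T Subset.⊆? value K) ℕ.* 𝟙 (i Subset.∈? value K))
               ≡⟨ ℕ.*-identityˡ _ ⟩
             𝟙 (value T Subset.⊆? value K) ℕ.* 𝟙 (i Subset.∈? value K)
               ≡⟨ 𝟙-× (value T Subset.⊆? value K) (i Subset.∈? value K) ⟨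
             𝟙 (value T Subset.⊆? value K ×-dec i Subset.∈? value K)
               ≡⟨ 𝟙-⇔ (T⁺⊆ K) (value T⁺ Subset.⊆? value K) (value T Subset.⊆? value K ×-dec i Subset.∈? value K) ⟨
             𝟙 (value T⁺ Subset.⊆? value K) ∎) ⟩
      count-superspaces k T⁺
        ≡⟨ count-superspaces≡gaussian j m T⁺ j≤m
             (≡.trans (≡.sym (ℕ.+-suc t m)) t+m≡n) (≡.trans (≡.sym (ℕ.+-suc t j)) t+j≡k) ⟩
      gaussian (q V) m j
        ≡⟨ ≡.trans (≡.cong (λ e → 1 ℕ.* e ℕ.* gaussian (q V) m j) (𝟙-true (i Subset.∈? Subset.⊤) Subset.∈⊤))
                   (ℕ.*-identityˡ _) ⟨
      1 ℕ.* 𝟙 (i Subset.∈? Subset.⊤) ℕ.* gaussian (q V) m j ∎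

-- Fraction-free elimination

module Elimination
  {A B : Set}
  (xs : List A) (xs-exhaustive : ∑ᶻ.Exhaustive xs) (_≟ᴬ_ : DecidableEquality A)
  (ys : List B) (ys-exhaustive : ∑ᶻ.Exhaustive ys) (_≟ᴮ_ : DecidableEquality B)
  (M : B → A → ℤ)
  where

  open ∑ᶻ
  open ≡.≡-Reasoning

  Spanned : (A → ℤ) → Set
  Spanned g = ∃ λ (a : B → ℤ) → ∀ x → g x ≡ ∑ ys (λ y → a y ℤ.* M y x)

  spanned-resp : ∀ {g h : A → ℤ} → (∀ x → h x ≡ g x) → Spanned g → Spanned h
  spanned-resp h≡g (a , eq) = a , λ x → ≡.trans (h≡g x) (eq x)

  spanned-row : ∀ y → Spanned (M y)
  spanned-row y = (λ z → 𝟙 (z ≟ᴮ y)) , λ x → ≡.sym (≡.trans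
    (∑-cong ys (λ z → ℤ.*-comm (𝟙 (z ≟ᴮ y)) (M z x)))
    (∑-δ ys ys-exhaustive _≟ᴮ_ (λ z → M z x) y))

  spanned-linear : ∀ α β {g h : A → ℤ} → Spanned g → Spanned h → Spanned (λ x → α ℤ.* g x ℤ.+ β ℤ.* h x)
  spanned-linear α β {g} {h} (a , g≡) (b , h≡) = (λ y → α ℤ.* a y ℤ.+ β ℤ.* b y) , λ x → begin
    α ℤ.* g x ℤ.+ β ℤ.* h x
      ≡⟨ ≡.cong₂ (λ u v → α ℤ.* u ℤ.+ β ℤ.* v) (g≡ x) (h≡ x) ⟩
    α ℤ.* ∑ ys (λ y → a y ℤ.* M y x) ℤ.+ β ℤ.* ∑ ys (λ y → b y ℤ.* M y x)
      ≡⟨ ≡.cong₂ ℤ._+_ (∑-*ˡ ys α (λ y → a y ℤ.* M y x)) (∑-*ˡ ys β (λ y → b y ℤ.* M y x)) ⟨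
    ∑ ys (λ y → α ℤ.* (a y ℤ.* M y x)) ℤ.+ ∑ ys (λ y → β ℤ.* (b y ℤ.* M y x))
      ≡⟨ ∑-+ ys (λ y → α ℤ.* (a y ℤ.* M y x)) (λ y → β ℤ.* (b y ℤ.* M y x)) ⟨
    ∑ ys (λ y → α ℤ.* (a y ℤ.* M y x) ℤ.+ β ℤ.* (b y ℤ.* M y x))
      ≡⟨ ∑-cong ys (λ y → solve 5 (λ α β a b m → α :* (a :* m) :+ β :* (b :* m) := (α :* a :+ β :* b) :* m)
           ≡.refl α β (a y) (b y) (M y x)) ⟩
    ∑ ys (λ y → (α ℤ.* a y ℤ.+ β ℤ.* b y) ℤ.* M y x) ∎
    where open ℤ-Solver

  spanned-∑ : ∀ (c : A → ℤ) (g : A → A → ℤ) → (∀ z → Spanned (g z)) → Spanned (λ x → ∑ xs (λ z → c z ℤ.* g z x))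
  spanned-∑ c g spanned = (λ y → ∑ xs (λ z → c z ℤ.* proj₁ (spanned z) y)) , λ x → ≡.trans
    (∑-cong xs (λ z → ≡.cong (c z ℤ.*_) (proj₂ (spanned z) x)))
    (∑-assoc xs ys c (proj₁ ∘ spanned) (λ y → M y x))

  -- The invariant of the elimination. The factor `D` makes division unnecessary, and `Q` is asked
  -- to annihilate only the rows treated so far.
  record Eliminated (rows : List B) : Set where
    field
      D       : ℤ
      D≢0     : D ≢ 0ℤ
      P Q     : A → A → ℤ
      split   : ∀ x z → D ℤ.* 𝟙 (x ≟ᴬ z) ≡ P x z ℤ.+ Q x z
      spanned : ∀ x → Spanned (P x)
      null    : All (λ y → ∀ z → ∑ xs (λ x → M y x ℤ.* Q x z) ≡ 0ℤ) rows

  -- Exhaustiveness speaks of sums only, so `f w` is first written as a sum against the indicator of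
  -- `w`, which vanishes term by term.
  zero-everywhere : {C : Set} (zs : List C) → Exhaustive zs → DecidableEquality C →
    ∀ (f : C → ℤ) → All (λ z → f z ≡ 0ℤ) zs → ∀ z → f z ≡ 0ℤ
  zero-everywhere {C} zs exhaustive _≟_ f f≡0 w =
    ≡.trans (≡.sym (∑-δ zs exhaustive _≟_ f w)) (vanishing zs f≡0)
    where
    vanishing : ∀ zs → All (λ z → f z ≡ 0ℤ) zs → ∑ zs (λ z → f z ℤ.* 𝟙 (z ≟ w)) ≡ 0ℤ
    vanishing []       []           = ≡.refl
    vanishing (z ∷ zs) (eq ∷ f≡0) =
      ≡.cong₂ (λ u v → u ℤ.* 𝟙 (z ≟ w) ℤ.+ v) eq (vanishing zs f≡0)

  -- One step of fraction-free elimination: if the new row r is not yet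
  -- annihilated by Q, then s = r Q has a pivot s j, and s is again in the row
  -- space because r (D I) = r P + r Q.
  eliminate : ∀ rows → Eliminated rows
  eliminate [] = record
    { D = ℤ.1ℤ ; D≢0 = λ () ; P = λ _ _ → 0ℤ ; Q = λ x z → ℤ.1ℤ ℤ.* 𝟙 (x ≟ᴬ z)
    ; split = λ x z → ≡.sym (ℤ.+-identityˡ _)
    ; spanned = λ _ → (λ _ → 0ℤ) , λ _ → ≡.sym (∑-zero ys (λ _ → ≡.refl))
    ; null = [] }
  eliminate (y ∷ rows) = by-pivot (all? (λ z → s z ℤ.≟ 0ℤ) xs)
    where
    open Eliminated (eliminate rows)
    s : A → ℤ
    s z = ∑ xs (λ x → M y x ℤ.* Q x z)

    s-spanned : Spanned s
    s-spanned = spanned-resp rearrange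
      (spanned-linear D ℤ.-1ℤ (spanned-row y) (spanned-∑ (M y) P spanned))
      where
      open ℤ-Solver
      rP : A → ℤ
      rP z = ∑ xs (λ x → M y x ℤ.* P x z)
      rearrange : ∀ z → s z ≡ D ℤ.* M y z ℤ.+ ℤ.-1ℤ ℤ.* rP z
      rearrange z = begin
        s z
          ≡⟨ solve 2 (λ s p → s := (p :+ s) :+ con ℤ.-1ℤ :* p) ≡.refl (s z) (rP z) ⟩
        (rP z ℤ.+ s z) ℤ.+ ℤ.-1ℤ ℤ.* rP z
          ≡⟨ ≡.cong (ℤ._+ ℤ.-1ℤ ℤ.* rP z) (begin
               rP z ℤ.+ s z
                 ≡⟨ ∑-+ xs (λ x → M y x ℤ.* P x z) (λ x → M y x ℤ.* Q x z) ⟨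
               ∑ xs (λ x → M y x ℤ.* P x z ℤ.+ M y x ℤ.* Q x z)
                 ≡⟨ ∑-cong xs (λ x → ≡.trans (≡.sym (ℤ.*-distribˡ-+ (M y x) (P x z) (Q x z)))
                                             (≡.cong (M y x ℤ.*_) (≡.sym (split x z)))) ⟩
               ∑ xs (λ x → M y x ℤ.* (D ℤ.* 𝟙 (x ≟ᴬ z)))
                 ≡⟨ ∑-cong xs (λ x → solve 3 (λ m d e → m :* (d :* e) := d :* (m :* e)) ≡.refl
                                       (M y x) D (𝟙 (x ≟ᴬ z))) ⟩
               ∑ xs (λ x → D ℤ.* (M y x ℤ.* 𝟙 (x ≟ᴬ z)))
                 ≡⟨ ∑-*ˡ xs D (λ x → M y x ℤ.* 𝟙 (x ≟ᴬ z)) ⟩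
               D ℤ.* ∑ xs (λ x → M y x ℤ.* 𝟙 (x ≟ᴬ z))
                 ≡⟨ ≡.cong (D ℤ.*_) (∑-δ xs xs-exhaustive _≟ᴬ_ (M y) z) ⟩
               D ℤ.* M y z ∎) ⟩
        D ℤ.* M y z ℤ.+ ℤ.-1ℤ ℤ.* rP z ∎

    by-pivot : Dec (All (λ z → s z ≡ 0ℤ) xs) → Eliminated (y ∷ rows)
    by-pivot (yes s≡0) = record
      { D = D ; D≢0 = D≢0 ; P = P ; Q = Q ; split = split ; spanned = spanned
      ; null = zero-everywhere xs xs-exhaustive _≟ᴬ_ s s≡0 ∷ null }
    by-pivot (no s≢0) with satisfied (¬All⇒Any¬ (λ z → s z ℤ.≟ 0ℤ) xs s≢0)
    ... | j , sj≢0 = record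
      { D = s j ℤ.* D
      ; D≢0 = λ eq → [ sj≢0 , D≢0 ]′ (ℤ.i*j≡0⇒i≡0∨j≡0 (s j) eq)
      -- After scaling by the pivot, the rank-one matrix with entries `Q x j * s z` moves from `Q`
      -- to `P`. Its rows are multiples of `s`, hence in the row space. The new `Q` sends row `y` to
      -- `s j * s - s j * s = 0`, and the earlier rows still to zero, since they annihilate column
      -- `j` as well.
      ; P = λ x z → s j ℤ.* P x z ℤ.+ Q x j ℤ.* s z
      ; Q = λ x z → s j ℤ.* Q x z ℤ.+ ℤ.- Q x j ℤ.* s z
      ; split = λ x z → begin
          s j ℤ.* D ℤ.* 𝟙 (x ≟ᴬ z)          ≡⟨ ℤ.*-assoc (s j) D (𝟙 (x ≟ᴬ z)) ⟩
          s j ℤ.* (D ℤ.* 𝟙 (x ≟ᴬ z))        ≡⟨ ≡.cong (s j ℤ.*_) (split x z) ⟩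
          s j ℤ.* (P x z ℤ.+ Q x z)
            ≡⟨ solve 5 (λ c p q b e → c :* (p :+ q) := (c :* p :+ b :* e) :+ (c :* q :+ (:- b) :* e))
                 ≡.refl (s j) (P x z) (Q x z) (Q x j) (s z) ⟩
          (s j ℤ.* P x z ℤ.+ Q x j ℤ.* s z) ℤ.+ (s j ℤ.* Q x z ℤ.+ ℤ.- Q x j ℤ.* s z) ∎
      ; spanned = λ x → spanned-linear (s j) (Q x j) (spanned x) s-spanned
      ; null = (λ z → ≡.trans (product y z)
                 (solve 2 (λ a b → a :* b :+ (:- b) :* a := con 0ℤ) ≡.refl (s j) (s z)))
             ∷ All.map (λ {r} rQ≡0 z → ≡.trans (product r z)
                 (≡.trans (≡.cong₂ (λ u v → s j ℤ.* u ℤ.+ ℤ.- s z ℤ.* v) (rQ≡0 z) (rQ≡0 j))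
                   (solve 2 (λ a b → a :* con 0ℤ :+ (:- b) :* con 0ℤ := con 0ℤ) ≡.refl (s j) (s z)))) null
      }
      where
      open ℤ-Solver
      product : ∀ r z → ∑ xs (λ x → M r x ℤ.* (s j ℤ.* Q x z ℤ.+ ℤ.- Q x j ℤ.* s z)) ≡
        s j ℤ.* ∑ xs (λ x → M r x ℤ.* Q x z) ℤ.+ ℤ.- s z ℤ.* ∑ xs (λ x → M r x ℤ.* Q x j)
      product r z = begin
        ∑ xs (λ x → M r x ℤ.* (s j ℤ.* Q x z ℤ.+ ℤ.- Q x j ℤ.* s z))
          ≡⟨ ∑-cong xs (λ x → solve 5 (λ m c q b e → m :* (c :* q :+ (:- b) :* e) :=
                                         c :* (m :* q) :+ (:- e) :* (m :* b))
               ≡.refl (M r x) (s j) (Q x z) (Q x j) (s z)) ⟩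
        ∑ xs (λ x → s j ℤ.* (M r x ℤ.* Q x z) ℤ.+ ℤ.- s z ℤ.* (M r x ℤ.* Q x j))
          ≡⟨ ∑-+ xs (λ x → s j ℤ.* (M r x ℤ.* Q x z)) (λ x → ℤ.- s z ℤ.* (M r x ℤ.* Q x j)) ⟩
        ∑ xs (λ x → s j ℤ.* (M r x ℤ.* Q x z)) ℤ.+ ∑ xs (λ x → ℤ.- s z ℤ.* (M r x ℤ.* Q x j))
          ≡⟨ ≡.cong₂ ℤ._+_ (∑-*ˡ xs (s j) (λ x → M r x ℤ.* Q x z)) (∑-*ˡ xs (ℤ.- s z) (λ x → M r x ℤ.* Q x j)) ⟩
        s j ℤ.* ∑ xs (λ x → M r x ℤ.* Q x z) ℤ.+ ℤ.- s z ℤ.* ∑ xs (λ x → M r x ℤ.* Q x j) ∎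

  open Eliminated (eliminate ys) public using (D; D≢0; P; Q; split; spanned)

  MQ≡0 : ∀ y z → ∑ xs (λ x → M y x ℤ.* Q x z) ≡ 0ℤ
  MQ≡0 y z = zero-everywhere ys ys-exhaustive _≟ᴮ_ (λ y → ∑ xs (λ x → M y x ℤ.* Q x z))
    (All.map (λ rQ≡0 → rQ≡0 z) (Eliminated.null (eliminate ys))) y

-- Designs with values in a commutative ring

f≤∑f : ∀ {V k} (f : Subspace V k → ℕ) K → f K ≤ ∑ᴺ.∑ (subspaces V k) f
f≤∑f {V} {k} f K = ≡.subst (ℕ._≤ ∑ (subspaces V k) f)
  (∑-δ (subspaces V k) (subspaces-exhaustive V k) _≟ˢ_ f K) (dominated (subspaces V k))
  where
  open ∑ᴺ
  𝟙≤1 : {P : Set} (p? : Dec P) → 𝟙 p? ℕ.≤ 1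
  𝟙≤1 p? with does p?
  ... | true  = ℕ.≤-refl
  ... | false = ℕ.z≤n
  dominated : ∀ xs → ∑ xs (λ x → f x ℕ.* 𝟙 (x ≟ˢ K)) ℕ.≤ ∑ xs f
  dominated []       = ℕ.z≤n
  dominated (x ∷ xs) = ℕ.+-mono-≤
    (ℕ.≤-trans (ℕ.*-monoʳ-≤ (f x) (𝟙≤1 (x ≟ˢ K))) (ℕ.≤-reflexive (ℕ.*-identityʳ (f x)))) (dominated xs)

∣i+n∣ : ∀ i n → ℤ.∣ i ∣ ℕ.≤ n → ℤ.+ ℤ.∣ i ℤ.+ ℤ.+ n ∣ ≡ i ℤ.+ ℤ.+ n
∣i+n∣ (ℤ.+ m)    n _    = ≡.refl
∣i+n∣ ℤ.-[1+ m ] n 1+m≤n rewrite ℤ.⊖-≥ 1+m≤n = ≡.refl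

module OverRing {c ℓ} (R : CommutativeRing c ℓ) where

  open CommutativeRing R

  -- The parameters make R an algebra over ℚ.
  module Designs
    (ι : ℤ → Carrier) (ι-+ : ∀ i j → ι (i ℤ.+ j) ≈ ι i + ι j) (ι-* : ∀ i j → ι (i ℤ.* j) ≈ ι i * ι j)
    (ι-0 : ι 0ℤ ≈ 0#) (ι-1 : ι ℤ.1ℤ ≈ 1#) (ι-invertible : ∀ i → i ≢ 0ℤ → ∃ λ r → r * ι i ≈ 1#)
    (V : Space) (k t : ℕ) (t≤k : t ≤ k) (k≤n : k ≤ rk V)
    (r : Carrier) (r-inverse : r * ι (ℤ.+ λmax V k t) ≈ 1#)
    where

    open ListSum commutativeSemiring
    open SetoidReasoning setoid
    open GroupProperties +-group using (∙-cancelʳ)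
    open CommutativeSemigroupProperties *-commutativeSemigroup using (x∙yz≈y∙xz)

    private
      Ks : List (Subspace V k)
      Ks = subspaces V k
      Ts : List (Subspace V t)
      Ts = subspaces V t

      Λ : Carrier
      Λ = ι (ℤ.+ λmax V k t)

    χᴿ : Subspace V t → Subspace V k → Carrier
    χᴿ T K = 𝟙 (value T Subset.⊆? value K)

    χᶻ : Subspace V t → Subspace V k → ℤ
    χᶻ T K = ∑ᶻ.𝟙 (value T Subset.⊆? value K)

    inner : (f g : Subspace V k → Carrier) → Carrier
    inner f g = ∑ Ks (λ K → f K * g K)

    Design : Carrier → (Subspace V k → Carrier) → Set ℓ
    Design l δ = ∀ T → inner (χᴿ T) δ ≈ l

    InRowSpace : (Subspace V k → Carrier) → Set _
    InRowSpace f = ∃ λ (a : Subspace V t → Carrier) → ∀ K → f K ≈ ∑ Ts (λ T → a T * χᴿ T K)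

    ConstantOnDesigns : (Subspace V k → Carrier) → Carrier → Set _
    ConstantOnDesigns f c = ∀ l δ → Design l δ → inner f δ ≈ l * c

    OrthogonalToNullDesigns : (Subspace V k → Carrier) → Set ℓ
    OrthogonalToNullDesigns f = ∀ (δ : Subspace V k → ℤ) → Design (ι 0ℤ) (ι ∘ δ) → inner f (ι ∘ δ) ≈ 0#

    ConstantOnNonNegativeDesigns : (Subspace V k → Carrier) → Carrier → Set ℓ
    ConstantOnNonNegativeDesigns f c = ∀ (l : ℕ) (δ : Subspace V k → ℕ) →
      Design (ι (ℤ.+ l)) (ι ∘ ℤ.+_ ∘ δ) → inner f (ι ∘ ℤ.+_ ∘ δ) ≈ ι (ℤ.+ l) * c

    ι-∑ : {A : Set} (xs : List A) (f : A → ℤ) → ι (∑ᶻ.∑ xs f) ≈ ∑ xs (ι ∘ f)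
    ι-∑ = ∑-homo ℤ.+-*-commutativeSemiring commutativeSemiring ι ι-+ ι-0

    ι-𝟙 : {P : Set} (p? : Dec P) → ι (∑ᶻ.𝟙 p?) ≈ 𝟙 p?
    ι-𝟙 p? with does p?
    ... | true  = ι-1
    ... | false = ι-0

    inner-cong : ∀ f {g h} → (∀ K → g K ≈ h K) → inner f g ≈ inner f h
    inner-cong f g≈h = ∑-cong Ks (λ K → *-congˡ (g≈h K))

    inner-+ : ∀ f g h → inner f (λ K → g K + h K) ≈ inner f g + inner f h
    inner-+ f g h = trans (∑-cong Ks (λ K → distribˡ (f K) (g K) (h K)))
                          (∑-+ Ks (λ K → f K * g K) (λ K → f K * h K))

    inner-* : ∀ f a g → inner f (λ K → a * g K) ≈ a * inner f g
    inner-* f a g = trans (∑-cong Ks (λ K → x∙yz≈y∙xz (f K) a (g K))) (∑-*ˡ Ks a (λ K → f K * g K))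

    inner-constant : ∀ f a → inner f (λ _ → a) ≈ a * ∑ Ks f
    inner-constant f a = trans (∑-*ʳ Ks a f) (*-comm (∑ Ks f) a)

    -- The count takes place in ℕ and is carried through ℤ, where `ι` starts.
    λmax-superspaces : ∀ T → ∑ Ks (χᴿ T) ≈ Λ
    λmax-superspaces T = begin
      ∑ Ks (χᴿ T)                        ≈⟨ ∑-cong Ks (λ K → ι-𝟙 (value T Subset.⊆? value K)) ⟨
      ∑ Ks (ι ∘ χᶻ T)                    ≈⟨ ι-∑ Ks (χᶻ T) ⟨
      ι (∑ᶻ.∑ Ks (χᶻ T))                 ≡⟨ ≡.cong ι (in-ℤ Ks) ⟩
      ι (ℤ.+ count-superspaces V k T)
        ≡⟨ ≡.cong (ι ∘ ℤ.+_) (count-superspaces≡gaussian V (k ∸ t) (rk V ∸ t) T (ℕ.∸-monoˡ-≤ t k≤n)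
             (ℕ.m+[n∸m]≡n (ℕ.≤-trans t≤k k≤n)) (ℕ.m+[n∸m]≡n t≤k)) ⟩
      Λ                                  ∎
      where
      𝟙ᶻ≡𝟙ᴺ : {P : Set} (p? : Dec P) → ∑ᶻ.𝟙 p? ≡ ℤ.+ ∑ᴺ.𝟙 p?
      𝟙ᶻ≡𝟙ᴺ p? with does p?
      ... | true  = ≡.refl
      ... | false = ≡.refl
      in-ℤ : ∀ Ks → ∑ᶻ.∑ Ks (χᶻ T) ≡ ℤ.+ ∑ᴺ.∑ Ks (λ K → ∑ᴺ.𝟙 (value T Subset.⊆? value K))
      in-ℤ []       = ≡.refl
      in-ℤ (K ∷ Ks) = ≡.cong₂ ℤ._+_ (𝟙ᶻ≡𝟙ᴺ (value T Subset.⊆? value K)) (in-ℤ Ks)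

    constant-design : ∀ a T → inner (χᴿ T) (λ _ → a) ≈ a * Λ
    constant-design a T = trans (inner-constant (χᴿ T) a) (*-congˡ (λmax-superspaces T))

    cancel-Λ : ∀ {a b} → Λ * a ≈ b → a ≈ r * b
    cancel-Λ {a} {b} Λa≈b = begin
      a             ≈⟨ *-identityˡ a ⟨
      1# * a        ≈⟨ *-congʳ r-inverse ⟨
      (r * Λ) * a   ≈⟨ *-assoc r Λ a ⟩
      r * (Λ * a)   ≈⟨ *-congˡ Λa≈b ⟩
      r * b         ∎

    module _ (f : Subspace V k → Carrier) where

      -- Every row of the inclusion matrix has inner product `l` with the design, so a combination
      -- of rows gives `l` times the sum of its coefficients.
      rowSpace⇒constant : InRowSpace f → ∃ (ConstantOnDesigns f)
      rowSpace⇒constant (a , f≈) = ∑ Ts a , λ l δ design → begin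
        inner f δ
          ≈⟨ ∑-cong Ks (λ K → trans (*-comm (f K) (δ K))
               (*-congˡ (trans (f≈ K) (∑-cong Ts (λ T → *-comm (a T) (χᴿ T K)))))) ⟩
        ∑ Ks (λ K → δ K * ∑ Ts (λ T → χᴿ T K * a T))
          ≈⟨ ∑-assoc Ks Ts δ (λ K T → χᴿ T K) a ⟩
        ∑ Ts (λ T → ∑ Ks (λ K → δ K * χᴿ T K) * a T)
          ≈⟨ ∑-cong Ts (λ T → *-congʳ (trans (∑-cong Ks (λ K → *-comm (δ K) (χᴿ T K))) (design T))) ⟩
        ∑ Ts (λ T → l * a T)
          ≈⟨ ∑-*ˡ Ts l a ⟩
        l * ∑ Ts a ∎

      constant⇒orthogonal : ∃ (ConstantOnDesigns f) → OrthogonalToNullDesigns f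
      constant⇒orthogonal (c , constant) δ null =
        trans (constant (ι 0ℤ) (ι ∘ δ) null) (trans (*-congʳ ι-0) (zeroˡ c))

      orthogonal⇒rowSpace : OrthogonalToNullDesigns f → InRowSpace f
      -- Let `C` be the matrix of `coefficient`, so that `P = C M`. Then `b` is the row vector
      -- `f C`, and `D f = f P = b M` is divided by `D`.
      orthogonal⇒rowSpace orthogonal = (λ T → d * b T) , λ K → begin
        f K                                  ≈⟨ *-identityˡ (f K) ⟨
        1# * f K                             ≈⟨ *-congʳ d-inverse ⟨
        (d * ι D) * f K                      ≈⟨ *-assoc d (ι D) (f K) ⟩
        d * (ι D * f K)                      ≈⟨ *-congˡ (expand K) ⟩
        d * ∑ Ts (λ T → b T * χᴿ T K)        ≈⟨ ∑-*ˡ Ts d (λ T → b T * χᴿ T K) ⟨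
        ∑ Ts (λ T → d * (b T * χᴿ T K))      ≈⟨ ∑-cong Ts (λ T → sym (*-assoc d (b T) (χᴿ T K))) ⟩
        ∑ Ts (λ T → (d * b T) * χᴿ T K)      ∎
        where
        open Elimination
          Ks (∑ᶻ.subspaces-exhaustive V k) _≟ˢ_ Ts (∑ᶻ.subspaces-exhaustive V t) _≟ˢ_ χᶻ
        d = proj₁ (ι-invertible D D≢0)
        d-inverse = proj₂ (ι-invertible D D≢0)
        coefficient : Subspace V k → Subspace V t → ℤ
        coefficient K = proj₁ (spanned K)
        b : Subspace V t → Carrier
        b T = ∑ Ks (λ K → f K * ι (coefficient K T))

        Q-null : ∀ K → Design (ι 0ℤ) (λ L → ι (Q L K))
        Q-null K T = begin
          ∑ Ks (λ L → χᴿ T L * ι (Q L K))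
            ≈⟨ ∑-cong Ks (λ L → trans (ι-* (χᶻ T L) (Q L K)) (*-congʳ (ι-𝟙 (value T Subset.⊆? value L)))) ⟨
          ∑ Ks (λ L → ι (χᶻ T L ℤ.* Q L K))     ≈⟨ ι-∑ Ks (λ L → χᶻ T L ℤ.* Q L K) ⟨
          ι (∑ᶻ.∑ Ks (λ L → χᶻ T L ℤ.* Q L K))  ≡⟨ ≡.cong ι (MQ≡0 T K) ⟩
          ι 0ℤ                                  ∎

        ι-P : ∀ L K → ι (P L K) ≈ ∑ Ts (λ T → ι (coefficient L T) * χᴿ T K)
        ι-P L K = begin
          ι (P L K)                                            ≡⟨ ≡.cong ι (proj₂ (spanned L) K) ⟩
          ι (∑ᶻ.∑ Ts (λ T → coefficient L T ℤ.* χᶻ T K))       ≈⟨ ι-∑ Ts (λ T → coefficient L T ℤ.* χᶻ T K) ⟩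
          ∑ Ts (λ T → ι (coefficient L T ℤ.* χᶻ T K))
            ≈⟨ ∑-cong Ts (λ T → trans (ι-* (coefficient L T) (χᶻ T K)) (*-congˡ (ι-𝟙 (value T Subset.⊆? value K)))) ⟩
          ∑ Ts (λ T → ι (coefficient L T) * χᴿ T K)            ∎

        ι-split : ∀ L K → ι D * 𝟙 (L ≟ˢ K) ≈ ι (P L K) + ι (Q L K)
        ι-split L K = begin
          ι D * 𝟙 (L ≟ˢ K)              ≈⟨ *-congˡ (ι-𝟙 (L ≟ˢ K)) ⟨
          ι D * ι (∑ᶻ.𝟙 (L ≟ˢ K))       ≈⟨ ι-* D (∑ᶻ.𝟙 (L ≟ˢ K)) ⟨
          ι (D ℤ.* ∑ᶻ.𝟙 (L ≟ˢ K))       ≡⟨ ≡.cong ι (split L K) ⟩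
          ι (P L K ℤ.+ Q L K)           ≈⟨ ι-+ (P L K) (Q L K) ⟩
          ι (P L K) + ι (Q L K)         ∎

        expand : ∀ K → ι D * f K ≈ ∑ Ts (λ T → b T * χᴿ T K)
        expand K = begin
          ι D * f K
            ≈⟨ *-congˡ (∑-δ Ks (subspaces-exhaustive V k) _≟ˢ_ f K) ⟨
          ι D * inner f (λ L → 𝟙 (L ≟ˢ K))
            ≈⟨ inner-* f (ι D) (λ L → 𝟙 (L ≟ˢ K)) ⟨
          inner f (λ L → ι D * 𝟙 (L ≟ˢ K))
            ≈⟨ inner-cong f (λ L → ι-split L K) ⟩
          inner f (λ L → ι (P L K) + ι (Q L K))
            ≈⟨ inner-+ f (λ L → ι (P L K)) (λ L → ι (Q L K)) ⟩
          inner f (λ L → ι (P L K)) + inner f (λ L → ι (Q L K))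
            ≈⟨ +-congˡ (orthogonal (λ L → Q L K) (Q-null K)) ⟩
          inner f (λ L → ι (P L K)) + 0#
            ≈⟨ +-identityʳ _ ⟩
          inner f (λ L → ι (P L K))
            ≈⟨ inner-cong f (λ L → ι-P L K) ⟩
          inner f (λ L → ∑ Ts (λ T → ι (coefficient L T) * χᴿ T K))
            ≈⟨ ∑-assoc Ks Ts f (λ L T → ι (coefficient L T)) (λ T → χᴿ T K) ⟩
          ∑ Ts (λ T → b T * χᴿ T K) ∎

      -- For a design δ with index l, the design λmax δ − l is null; it is written
      -- δ₀ with δ₀ + l = λmax δ.
      orthogonal⇒constantNonNegative : OrthogonalToNullDesigns f → ConstantOnNonNegativeDesigns f (r * ∑ Ks f)
      orthogonal⇒constantNonNegative orthogonal l δ design = begin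
        inner f δᴿ                  ≈⟨ cancel-Λ (begin
          Λ * inner f δᴿ              ≈⟨ split-inner f ⟩
          inner f (ι ∘ δ₀) + inner f (λ _ → lᴿ)
            ≈⟨ +-cong (orthogonal δ₀ δ₀-null) (inner-constant f lᴿ) ⟩
          0# + lᴿ * ∑ Ks f            ≈⟨ +-identityˡ _ ⟩
          lᴿ * ∑ Ks f                 ∎) ⟩
        r * (lᴿ * ∑ Ks f)           ≈⟨ x∙yz≈y∙xz r lᴿ (∑ Ks f) ⟩
        lᴿ * (r * ∑ Ks f)           ∎
        where
        open ℤ-Solver using (solve; _:=_; _:+_; _:-_)
        lᴿ : Carrier
        lᴿ = ι (ℤ.+ l)
        δᴿ : Subspace V k → Carrier
        δᴿ = ι ∘ ℤ.+_ ∘ δ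
        δ₀ : Subspace V k → ℤ
        δ₀ K = ℤ.+ λmax V k t ℤ.* ℤ.+ δ K ℤ.- ℤ.+ l
        δ₀+l : ∀ K → Λ * δᴿ K ≈ ι (δ₀ K) + lᴿ
        δ₀+l K = begin
          Λ * δᴿ K                            ≈⟨ ι-* (ℤ.+ λmax V k t) (ℤ.+ δ K) ⟨
          ι (ℤ.+ λmax V k t ℤ.* ℤ.+ δ K)
            ≡⟨ ≡.cong ι (solve 2 (λ m l → m :- l :+ l := m) ≡.refl (ℤ.+ λmax V k t ℤ.* ℤ.+ δ K) (ℤ.+ l)) ⟨
          ι (δ₀ K ℤ.+ ℤ.+ l)                  ≈⟨ ι-+ (δ₀ K) (ℤ.+ l) ⟩
          ι (δ₀ K) + lᴿ                       ∎
        split-inner : ∀ g → Λ * inner g δᴿ ≈ inner g (ι ∘ δ₀) + inner g (λ _ → lᴿ)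
        split-inner g = begin
          Λ * inner g δᴿ                          ≈⟨ inner-* g Λ δᴿ ⟨
          inner g (λ K → Λ * δᴿ K)                ≈⟨ inner-cong g δ₀+l ⟩
          inner g (λ K → ι (δ₀ K) + lᴿ)           ≈⟨ inner-+ g (ι ∘ δ₀) (λ _ → lᴿ) ⟩
          inner g (ι ∘ δ₀) + inner g (λ _ → lᴿ)   ∎
        δ₀-null : Design (ι 0ℤ) (ι ∘ δ₀)
        -- The term `lᴿ * Λ` added on both sides is the index of the constant function `lᴿ`.
        δ₀-null T = ∙-cancelʳ (lᴿ * Λ) _ _ (begin
          inner (χᴿ T) (ι ∘ δ₀) + lᴿ * Λ                    ≈⟨ +-congˡ (constant-design lᴿ T) ⟨
          inner (χᴿ T) (ι ∘ δ₀) + inner (χᴿ T) (λ _ → lᴿ)   ≈⟨ split-inner (χᴿ T) ⟨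
          Λ * inner (χᴿ T) δᴿ                               ≈⟨ *-congˡ (design T) ⟩
          Λ * lᴿ                                            ≈⟨ *-comm Λ lᴿ ⟩
          lᴿ * Λ                                            ≈⟨ +-identityˡ (lᴿ * Λ) ⟨
          0# + lᴿ * Λ                                       ≈⟨ +-congʳ ι-0 ⟨
          ι 0ℤ + lᴿ * Λ                                     ∎)

      -- Test against the complete design, in which every `K` occurs once and whose index is λmax.
      constantNonNegative-total : ∀ {c} → ConstantOnNonNegativeDesigns f c → Λ * c ≈ ∑ Ks f
      constantNonNegative-total {c} constant = begin
        Λ * c                       ≈⟨ constant (λmax V k t) (λ _ → 1) (λ T →
                                         trans (constant-design (ι ℤ.1ℤ) T) (trans (*-congʳ ι-1) (*-identityˡ Λ))) ⟨
        inner f (λ _ → ι ℤ.1ℤ)      ≈⟨ inner-constant f (ι ℤ.1ℤ) ⟩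
        ι ℤ.1ℤ * ∑ Ks f             ≈⟨ *-congʳ ι-1 ⟩
        1# * ∑ Ks f                 ≈⟨ *-identityˡ (∑ Ks f) ⟩
        ∑ Ks f                      ∎

      constantNonNegative-unique : ∀ c → ConstantOnNonNegativeDesigns f c → c ≈ r * ∑ Ks f
      constantNonNegative-unique c constant = cancel-Λ (constantNonNegative-total constant)

      constant-unique : ∀ c → ConstantOnDesigns f c → c ≈ r * ∑ Ks f
      constant-unique c constant = constantNonNegative-unique c (λ l δ → constant (ι (ℤ.+ l)) (ι ∘ ℤ.+_ ∘ δ))

      -- A null design becomes non-negative when a large constant N is added.
      constantNonNegative⇒orthogonal : ∃ (ConstantOnNonNegativeDesigns f) → OrthogonalToNullDesigns f
      -- The shifted design has index N λmax. By `constantNonNegative-total`, its inner product with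
      -- `f` is N times the total of `f`, precisely the contribution of the shift, so nothing is
      -- left for `δ`.
      constantNonNegative⇒orthogonal (c , constant) δ null = ∙-cancelʳ (Nᴿ * ∑ Ks f) _ _ (begin
        inner f (ι ∘ δ) + Nᴿ * ∑ Ks f          ≈⟨ split-inner f ⟨
        inner f (ι ∘ ℤ.+_ ∘ δ⁺)                ≈⟨ constant (N ℕ.* λmax V k t) δ⁺ δ⁺-design ⟩
        ι (ℤ.+ (N ℕ.* λmax V k t)) * c         ≈⟨ *-congʳ ι-NΛ ⟩
        (Nᴿ * Λ) * c                           ≈⟨ *-assoc Nᴿ Λ c ⟩
        Nᴿ * (Λ * c)                           ≈⟨ *-congˡ (constantNonNegative-total constant) ⟩
        Nᴿ * ∑ Ks f                            ≈⟨ +-identityˡ _ ⟨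
        0# + Nᴿ * ∑ Ks f                       ∎)
        where
        N : ℕ
        -- The sum of all absolute values bounds each of them, so the absolute value in `δ⁺` changes
        -- nothing and merely lands in ℕ.
        N = ∑ᴺ.∑ Ks (ℤ.∣_∣ ∘ δ)
        Nᴿ : Carrier
        Nᴿ = ι (ℤ.+ N)
        δ⁺ : Subspace V k → ℕ
        δ⁺ K = ℤ.∣ δ K ℤ.+ ℤ.+ N ∣
        ι-NΛ : ι (ℤ.+ (N ℕ.* λmax V k t)) ≈ Nᴿ * Λ
        ι-NΛ = trans (reflexive (≡.cong ι (ℤ.pos-* N (λmax V k t)))) (ι-* (ℤ.+ N) (ℤ.+ λmax V k t))
        split-inner : ∀ g → inner g (ι ∘ ℤ.+_ ∘ δ⁺) ≈ inner g (ι ∘ δ) + Nᴿ * ∑ Ks g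
        split-inner g = begin
          inner g (ι ∘ ℤ.+_ ∘ δ⁺)
            ≈⟨ inner-cong g (λ K → trans (reflexive (≡.cong ι (∣i+n∣ (δ K) N (f≤∑f (ℤ.∣_∣ ∘ δ) K))))
                                         (ι-+ (δ K) (ℤ.+ N))) ⟩
          inner g (λ K → ι (δ K) + Nᴿ)               ≈⟨ inner-+ g (ι ∘ δ) (λ _ → Nᴿ) ⟩
          inner g (ι ∘ δ) + inner g (λ _ → Nᴿ)       ≈⟨ +-congˡ (inner-constant g Nᴿ) ⟩
          inner g (ι ∘ δ) + Nᴿ * ∑ Ks g              ∎
        δ⁺-design : Design (ι (ℤ.+ (N ℕ.* λmax V k t))) (ι ∘ ℤ.+_ ∘ δ⁺)
        δ⁺-design T = begin
          inner (χᴿ T) (ι ∘ ℤ.+_ ∘ δ⁺)               ≈⟨ split-inner (χᴿ T) ⟩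
          inner (χᴿ T) (ι ∘ δ) + Nᴿ * ∑ Ks (χᴿ T)    ≈⟨ +-cong (trans (null T) ι-0) (*-congˡ (λmax-superspaces T)) ⟩
          0# + Nᴿ * Λ                                ≈⟨ +-identityˡ _ ⟩
          Nᴿ * Λ                                     ≈⟨ ι-NΛ ⟨
          ι (ℤ.+ (N ℕ.* λmax V k t))                 ∎

-- Real designs

fromℤ-invertible : ∀ i → i ≢ 0ℤ → ∃ λ r → r ⊗ fromℤ i ≈ᴿ 1ᴿ
fromℤ-invertible i i≢0 = r , ≡.subst (_≈ᴿ 1ᴿ) (≡.sym (⊗≡*ᴿ r (fromℤ i)))
  (pointwise {r *ᴿ fromℤ i} {1ᴿ} λ _ → ℚ.*-inverseˡ (i ℚ./ 1))
  where
  instance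
    i/1-nonZero : ℚ.NonZero (i ℚ./ 1)
    i/1-nonZero = ℚ.≢-nonZero (/1-nonZero i≢0)
  r : ℝ
  r = fromℚ (ℚ.1/ (i ℚ./ 1))

fromℤ-⊕ : ∀ i j → fromℤ (i ℤ.+ j) ≈ᴿ fromℤ i ⊕ fromℤ j
fromℤ-⊕ i j = ≡.subst (fromℤ (i ℤ.+ j) ≈ᴿ_) (≡.sym (⊕≡+ᴿ (fromℤ i) (fromℤ j)))
  (pointwise {fromℤ (i ℤ.+ j)} {fromℤ i +ᴿ fromℤ j} λ _ → fromℤ-+ i j)

fromℤ-⊗ : ∀ i j → fromℤ (i ℤ.* j) ≈ᴿ fromℤ i ⊗ fromℤ j
fromℤ-⊗ i j = ≡.subst (fromℤ (i ℤ.* j) ≈ᴿ_) (≡.sym (⊗≡*ᴿ (fromℤ i) (fromℤ j)))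
  (pointwise {fromℤ (i ℤ.* j)} {fromℤ i *ᴿ fromℤ j} λ _ → fromℤ-* i j)

reciprocal-inverse : ∀ m .{{_ : ℕ.NonZero m}} → reciprocal m ⊗ fromℕ m ≈ᴿ 1ᴿ
reciprocal-inverse m = ≡.subst (_≈ᴿ 1ᴿ) (≡.sym (⊗≡*ᴿ (reciprocal m) (fromℕ m)))
  (pointwise {reciprocal m *ᴿ fromℕ m} {1ᴿ} λ _ → 1/m*m≡1 m)

module ∑ᴿ = ListSum (CommutativeRing.commutativeSemiring ℝ-commutativeRing)

-- The opaque operations are only propositionally equal to those of the statement, so sums are
-- converted step by step along the list.
foldr-≗ : {A C : Set} (c d : A → C → C) (z : C) → (∀ x s → c x s ≡ d x s) →
  ∀ xs → foldr c z xs ≡ foldr d z xs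
foldr-≗ c d z c≗d []       = ≡.refl
foldr-≗ c d z c≗d (x ∷ xs) = ≡.trans (c≗d x (foldr c z xs)) (≡.cong (d x) (foldr-≗ c d z c≗d xs))

∑≡sumᴿ : ∀ {A : Set} (xs : List A) (f g : A → ℝ) → (∀ x → f x ≡ g x) → ∑ᴿ.∑ xs f ≡ sumᴿ xs g
∑≡sumᴿ xs f g f≗g = foldr-≗ (λ x s → f x ⊕ s) (λ x s → g x +ᴿ s) 0ᴿ
  (λ x s → ≡.trans (≡.cong (λ a → a ⊕ s) (f≗g x)) (⊕≡+ᴿ (g x) s)) xs

≈ᴿ-resp-≡ : ∀ a b x y → a ≡ b → x ≡ y → a ≈ᴿ x → b ≈ᴿ y
≈ᴿ-resp-≡ a b x y ≡.refl ≡.refl a≈x = a≈x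

-- _∘_ is inlined in the bodies of definitions but not in their types; this is
-- how to pass from one form to the other without unfolding a function of it.
∘-intro : ∀ {A B C : Set} (h : B → C) (S : (A → C) → Set) (g : A → B) → S (λ x → h (g x)) → S (h ∘ g)
∘-intro h S g s = s

∘-elim : ∀ {A B C : Set} (h : B → C) (S : (A → C) → Set) (g : A → B) → S (h ∘ g) → S (λ x → h (g x))
∘-elim h S g s = s

module RealDesigns (V : Space) (k t : ℕ) (t≤k : t ≤ k) (k≤n : k ≤ rk V) where

  open OverRing.Designs ℝ-commutativeRing fromℤ fromℤ-⊕ fromℤ-⊗
    (pointwise {fromℤ 0ℤ} {0ᴿ} λ _ → ≡.refl) (pointwise {fromℤ ℤ.1ℤ} {1ᴿ} λ _ → ≡.refl)
    fromℤ-invertible V k t t≤k k≤n (reciprocal (λmax V k t) {{λmax-nonZero V t k≤n}})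
    (reciprocal-inverse (λmax V k t) {{λmax-nonZero V t k≤n}}) public

  χᴿ≡χ : ∀ T K → χᴿ T K ≡ χ T K
  χᴿ≡χ T K = ≡.refl

  inner≡⟨⟩ : ∀ f g → inner f g ≡ ⟨ f , g ⟩
  inner≡⟨⟩ f g = ∑≡sumᴿ (subspaces V k) (λ K → f K ⊗ g K) (λ K → f K *ᴿ g K) (λ K → ⊗≡*ᴿ (f K) (g K))

  inner-χ≡⟨⟩ : ∀ T δ → inner (χᴿ T) δ ≡ ⟨ χ T , δ ⟩
  inner-χ≡⟨⟩ T δ = ∑≡sumᴿ (subspaces V k) (λ K → χᴿ T K ⊗ δ K) (λ K → χ T K *ᴿ δ K)
    (λ K → ≡.trans (≡.cong (λ a → a ⊗ δ K) (χᴿ≡χ T K)) (⊗≡*ᴿ (χ T K) (δ K)))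

  combination≡ : ∀ (a : Subspace V t → ℝ) K →
    ∑ᴿ.∑ (subspaces V t) (λ T → a T ⊗ χᴿ T K) ≡ sumᴿ (subspaces V t) (λ T → a T *ᴿ χ T K)
  combination≡ a K = ∑≡sumᴿ (subspaces V t) (λ T → a T ⊗ χᴿ T K) (λ T → a T *ᴿ χ T K)
    (λ T → ≡.trans (≡.cong (λ b → a T ⊗ b) (χᴿ≡χ T K)) (⊗≡*ᴿ (a T) (χ T K)))

  total≡ : ∀ (f : Subspace V k → ℝ) a → a ⊗ ∑ᴿ.∑ (subspaces V k) f ≡ a *ᴿ # f
  total≡ f a = ≡.trans (≡.cong (λ s → a ⊗ s) (∑≡sumᴿ (subspaces V k) f f (λ K → ≡.refl))) (⊗≡*ᴿ a (# f))

  inSpan⇔inRowSpace : ∀ f → InSpan t f ⇔ InRowSpace f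
  inSpan⇔inRowSpace f = mk⇔
    (λ (a , f≈) → a , λ K → ≈ᴿ-resp-≡ (f K) (f K) (span a K) (rowSpan a K) ≡.refl (≡.sym (combination≡ a K)) (f≈ K))
    (λ (a , f≈) → a , λ K → ≈ᴿ-resp-≡ (f K) (f K) (rowSpan a K) (span a K) ≡.refl (combination≡ a K) (f≈ K))
    where
    span rowSpan : (Subspace V t → ℝ) → Subspace V k → ℝ
    span a K = sumᴿ (subspaces V t) (λ T → a T *ᴿ χ T K)
    rowSpan a K = ∑ᴿ.∑ (subspaces V t) (λ T → a T ⊗ χᴿ T K)

  isDesign⇔design : ∀ l δ → IsDesign t l δ ⇔ Design l δ
  isDesign⇔design l δ = mk⇔
    (λ design T → ≈ᴿ-resp-≡ ⟨ χ T , δ ⟩ (inner (χᴿ T) δ) l l (≡.sym (inner-χ≡⟨⟩ T δ)) ≡.refl (design T))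
    (λ design T → ≈ᴿ-resp-≡ (inner (χᴿ T) δ) ⟨ χ T , δ ⟩ l l (inner-χ≡⟨⟩ T δ) ≡.refl (design T))

  module _ (f : Subspace V k → ℝ) where

    open Equivalence using (to; from)

    -- Stated for a single `δ`, so that it serves (ii) and, with an index and values coming from ℕ,
    -- also (iv).
    index⇔ : ∀ l c δ → (IsDesign t l δ → ⟨ f , δ ⟩ ≈ᴿ l *ᴿ c) ⇔ (Design l δ → inner f δ ≈ᴿ l ⊗ c)
    index⇔ l c δ = mk⇔
      (λ constant design → ≈ᴿ-resp-≡ ⟨ f , δ ⟩ (inner f δ) (l *ᴿ c) (l ⊗ c)
        (≡.sym (inner≡⟨⟩ f δ)) (≡.sym (⊗≡*ᴿ l c)) (constant (from (isDesign⇔design l δ) design)))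
      (λ constant design → ≈ᴿ-resp-≡ (inner f δ) ⟨ f , δ ⟩ (l ⊗ c) (l *ᴿ c)
        (inner≡⟨⟩ f δ) (⊗≡*ᴿ l c) (constant (to (isDesign⇔design l δ) design)))

    null⇔ : ∀ δ → (IsDesign t (fromℤ 0ℤ) δ → ⟨ f , δ ⟩ ≈ᴿ 0ᴿ) ⇔ (Design (fromℤ 0ℤ) δ → inner f δ ≈ᴿ 0ᴿ)
    null⇔ δ = mk⇔
      (λ orthogonal null → ≈ᴿ-resp-≡ ⟨ f , δ ⟩ (inner f δ) 0ᴿ 0ᴿ (≡.sym (inner≡⟨⟩ f δ)) ≡.refl
        (orthogonal (from (isDesign⇔design (fromℤ 0ℤ) δ) null)))
      (λ orthogonal null → ≈ᴿ-resp-≡ (inner f δ) ⟨ f , δ ⟩ 0ᴿ 0ᴿ (inner≡⟨⟩ f δ) ≡.refl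
        (orthogonal (to (isDesign⇔design (fromℤ 0ℤ) δ) null)))

    constant⇒[ii] : ∀ c → ConstantOnDesigns f c →
      ∀ (l : ℝ) (δ : Subspace V k → ℝ) → IsDesign t l δ → ⟨ f , δ ⟩ ≈ᴿ l *ᴿ c
    constant⇒[ii] c constant l δ = from (index⇔ l c δ) (constant l δ)

    [ii]⇒constant : ∀ c → (∀ (l : ℝ) (δ : Subspace V k → ℝ) → IsDesign t l δ → ⟨ f , δ ⟩ ≈ᴿ l *ᴿ c) →
      ConstantOnDesigns f c
    [ii]⇒constant c ii l δ = to (index⇔ l c δ) (ii l δ)

    orthogonal⇒[iii] : OrthogonalToNullDesigns f →
      ∀ (δ : Subspace V k → ℤ) → IsSignedDesign t 0ℤ δ → ⟨ f , fromℤ ∘ δ ⟩ ≈ᴿ 0ᴿ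
    orthogonal⇒[iii] orthogonal δ null = ∘-intro fromℤ (λ g → ⟨ f , g ⟩ ≈ᴿ 0ᴿ) δ
      (from (null⇔ (λ K → fromℤ (δ K))) (orthogonal δ) null)

    [iii]⇒orthogonal : (∀ (δ : Subspace V k → ℤ) → IsSignedDesign t 0ℤ δ → ⟨ f , fromℤ ∘ δ ⟩ ≈ᴿ 0ᴿ) →
      OrthogonalToNullDesigns f
    [iii]⇒orthogonal iii δ = to (null⇔ (λ K → fromℤ (δ K))) (λ null →
      ∘-elim fromℤ (λ g → ⟨ f , g ⟩ ≈ᴿ 0ᴿ) δ (iii δ null))

    constantNonNegative⇒[iv] : ∀ c → ConstantOnNonNegativeDesigns f c →
      ∀ (l : ℕ) (δ : Subspace V k → ℕ) → IsNonNegativeDesign t l δ → ⟨ f , fromℕ ∘ δ ⟩ ≈ᴿ fromℕ l *ᴿ c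
    constantNonNegative⇒[iv] c constant l δ design = ∘-intro fromℕ (λ g → ⟨ f , g ⟩ ≈ᴿ fromℕ l *ᴿ c) δ
      (from (index⇔ (fromℕ l) c (λ K → fromℕ (δ K))) (constant l δ) design)

    [iv]⇒constantNonNegative : ∀ c →
      (∀ (l : ℕ) (δ : Subspace V k → ℕ) → IsNonNegativeDesign t l δ → ⟨ f , fromℕ ∘ δ ⟩ ≈ᴿ fromℕ l *ᴿ c) →
      ConstantOnNonNegativeDesigns f c
    [iv]⇒constantNonNegative c iv l δ = to (index⇔ (fromℕ l) c (λ K → fromℕ (δ K))) (λ design →
      ∘-elim fromℕ (λ g → ⟨ f , g ⟩ ≈ᴿ fromℕ l *ᴿ c) δ (iv l δ design))

    ⊗⇒*ᴿ : ∀ a c → c ≈ᴿ a ⊗ ∑ᴿ.∑ (subspaces V k) f → c ≈ᴿ a *ᴿ # f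
    ⊗⇒*ᴿ a c = ≈ᴿ-resp-≡ c c (a ⊗ ∑ᴿ.∑ (subspaces V k) f) (a *ᴿ # f) ≡.refl (total≡ f a)

theorem3p5 :
  (V : Space) (k t : ℕ) (k≤n : k ≤ rk V) → t ≤ k ⊓ (rk V ∸ k) →
  (f : Subspace V k → ℝ) →
  let
    [i] : Set
    [i] = InSpan t f

    [ii] : ℝ → Set
    [ii] c = ∀ (l : ℝ) (δ : Subspace V k → ℝ) → IsDesign t l δ →
             ⟨ f , δ ⟩ ≈ᴿ l *ᴿ c

    [iii] : Set
    [iii] = ∀ (δ : Subspace V k → ℤ) → IsSignedDesign t 0ℤ δ →
            ⟨ f , fromℤ ∘ δ ⟩ ≈ᴿ 0ᴿ

    [iv] : ℝ → Set
    [iv] c = ∀ (l : ℕ) (δ : Subspace V k → ℕ) → IsNonNegativeDesign t l δ →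
             ⟨ f , fromℕ ∘ δ ⟩ ≈ᴿ fromℕ l *ᴿ c

    c₀ : ℝ
    c₀ = reciprocal (λmax V k t) {{λmax-nonZero V t k≤n}} *ᴿ # f
  in
    ([i] ⇔ ∃ [ii]) × (∃ [ii] ⇔ [iii]) × ([iii] ⇔ ∃ [iv])
    × (∀ c → [ii] c → c ≈ᴿ c₀)
    × (∀ c → [iv] c → c ≈ᴿ c₀)
theorem3p5 V k t k≤n t≤k⊓[n∸k] f =
    mk⇔ (ii ∘ rowSpace⇒constant f ∘ to (inSpan⇔inRowSpace f))
        -- The way from (ii) back to (i) leads through (iii).
        (from (inSpan⇔inRowSpace f) ∘ orthogonal⇒rowSpace f ∘ constant⇒orthogonal f ∘ ii⁻)
  , mk⇔ (orthogonal⇒[iii] f ∘ constant⇒orthogonal f ∘ ii⁻)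
        (ii ∘ rowSpace⇒constant f ∘ orthogonal⇒rowSpace f ∘ [iii]⇒orthogonal f)
  , mk⇔ (λ iii → c₁ , constantNonNegative⇒[iv] f c₁ (orthogonal⇒constantNonNegative f ([iii]⇒orthogonal f iii)))
        (λ (c , iv) → orthogonal⇒[iii] f (constantNonNegative⇒orthogonal f (c , [iv]⇒constantNonNegative f c iv)))
  , (λ c ii → ⊗⇒*ᴿ f r c (constant-unique f c ([ii]⇒constant f c ii)))
  , (λ c iv → ⊗⇒*ᴿ f r c (constantNonNegative-unique f c ([iv]⇒constantNonNegative f c iv)))
  where
  open RealDesigns V k t (ℕ.≤-trans t≤k⊓[n∸k] (ℕ.m⊓n≤m k (rk V ∸ k))) k≤n
  open Equivalence using (to; from)
  r c₁ : ℝ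
  r = reciprocal (λmax V k t) {{λmax-nonZero V t k≤n}}
  -- The constant `c₀` of the statement, written with the opaque operations.
  c₁ = r ⊗ ∑ᴿ.∑ (subspaces V k) f
  ii : ∃ (ConstantOnDesigns f) → ∃ λ c → ∀ (l : ℝ) (δ : Subspace V k → ℝ) → IsDesign t l δ → ⟨ f , δ ⟩ ≈ᴿ l *ᴿ c
  ii (c , constant) = c , constant⇒[ii] f c constant
  ii⁻ : (∃ λ c → ∀ (l : ℝ) (δ : Subspace V k → ℝ) → IsDesign t l δ → ⟨ f , δ ⟩ ≈ᴿ l *ᴿ c) →
    ∃ (ConstantOnDesigns f)
  ii⁻ (c , constant) = c , [ii]⇒constant f c constant
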